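{- Let $n$ and $k$ be integers with $3\le k\le n-2$. Among all trees on $n$ vertices with exactly $k$ pendent vertices, $BS_{n,k}$ is the unique tree having maximal Harary index.
   Context: A pendent vertex is a vertex of degree $1$. The Harary index of a connected graph $G$ is $H(G)=\sum_{\{x,y\}\subseteq V(G),\,x\ne y}\frac{1}{d(x,y)}$, $d$ the shortest-path distance. $BS_{n,k}$ is the balanced starlike tree: the tree on $n$ vertices consisting of a vertex $v$ such that removing $v$ leaves $k$ disjoint paths with $n_1,\dots,n_k$ vertices ($n_1+\dots+n_k=n-1$, $|n_i-n_j|\le 1$ for all $i,j$), $v$ being adjacent to an endvertex of each path. -}

module Defs where

open import Data.Nat as ℕ using (ℕ; zero; suc; _+_; _≤_; _<ᵇ_; _≡ᵇ_; _≤ᵇ_)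
open import Data.Bool using (Bool; true; false; _∧_; _∨_; not; if_then_else_)
open import Data.Fin using (Fin; toℕ)
open import Data.List using (List; map; filter; length; foldr)
open import Data.Nat.ListAction using (sum)
open import Data.Nat.Properties using (≡⇒≡ᵇ)

open import Data.List.Base using (allFin)
open import Data.Rational as ℚ using (ℚ; 0ℚ)
open import Data.Integer using (+_)
open import Relation.Binary.PropositionalEquality using (_≡_)
open import Function.Bundles using (_↔_; Inverse)
open import Data.Product using (Σ; _×_)

record Graph (n : ℕ) : Set where
  field
    adj    : Fin n → Fin n → Bool
    sym    : ∀ x y → adj x y ≡ adj y x
    irrefl : ∀ x → adj x x ≡ false
open Graph public

_==_ : ∀ {n} → Fin n → Fin n → Bool
x == y = toℕ x ≡ᵇ toℕ y

anyV : ∀ {n} → (Fin n → Bool) → Bool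
anyV {n} p = foldr (λ x b → p x ∨ b) false (allFin n)

within : ∀ {n} → Graph n → ℕ → Fin n → Fin n → Bool
within G zero    x y = x == y
within G (suc k) x y = within G k x y ∨ anyV (λ z → adj G x z ∧ within G k z y)

Connected : ∀ {n} → Graph n → Set
Connected {n} G = ∀ x y → within G n x y ≡ true

degree : ∀ {n} → Graph n → Fin n → ℕ
degree {n} G x = length (filter (λ z → adj G x z Data.Bool.≟ true) (allFin n))
  where import Data.Bool

edgeCount : ∀ {n} → Graph n → ℕ
edgeCount {n} G =
  sum (map (λ x → sum (map (λ y → if (toℕ x <ᵇ toℕ y) ∧ adj G x y then 1 else 0)
                           (allFin n)))
           (allFin n))

IsTree : ∀ {n} → Graph n → Set
IsTree {n} G = Connected G × edgeCount G ≡ n ℕ.∸ 1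

pendentCount : ∀ {n} → Graph n → ℕ
pendentCount {n} G = length (filter (λ x → degree G x ℕ.≟ 1) (allFin n))

-- shortest-path distance: least k ≤ n with a walk of length ≤ k
-- (for a connected graph this is the true distance d(x,y))
distFrom : ∀ {n} → Graph n → Fin n → Fin n → ℕ → ℕ → ℕ
distFrom G x y k zero    = k
distFrom G x y k (suc f) = if within G k x y then k else distFrom G x y (suc k) f

dist : ∀ {n} → Graph n → Fin n → Fin n → ℕ
dist {n} G x y = distFrom G x y 0 n

-- 1/d as a rational (only used for d ≥ 1)
recip : ℕ → ℚ
recip zero    = 0ℚ
recip (suc m) = (+ 1) ℚ./ suc m

harary : ∀ {n} → Graph n → ℚ
harary {n} G =
  foldr ℚ._+_ 0ℚ
    (map (λ x → foldr ℚ._+_ 0ℚ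
           (map (λ y → if toℕ x <ᵇ toℕ y then recip (dist G x y) else 0ℚ)
                (allFin n)))
         (allFin n))

_≅_ : ∀ {n} → Graph n → Graph n → Set
_≅_ {n} G H = Σ (Fin n ↔ Fin n) λ f → ∀ x y → adj H (Inverse.to f x) (Inverse.to f y) ≡ adj G x y

-- The balanced starlike tree BS_{n,k}: vertex 0 is the centre; vertex j ≥ 1
-- lies on path number (j-1) mod k at depth ⌊(j-1)/k⌋ + 1.  Thus 0 ~ j for
-- 1 ≤ j ≤ k, and i ~ j for 1 ≤ i and j = i + k.  The k paths then have
-- ⌈(n-1)/k⌉ or ⌊(n-1)/k⌋ vertices each, i.e. they are balanced.
bsAdjℕ : ℕ → ℕ → ℕ → Bool
bsAdjℕ k a b =
  ((a ≡ᵇ 0) ∧ (1 ≤ᵇ b) ∧ (b ≤ᵇ k)) ∨ ((1 ≤ᵇ a) ∧ (b ≡ᵇ a + k))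

bsAdj : ∀ {n} → ℕ → Fin n → Fin n → Bool
bsAdj k x y = not (x == y) ∧ (bsAdjℕ k (toℕ x) (toℕ y) ∨ bsAdjℕ k (toℕ y) (toℕ x))

BS : (n k : ℕ) → Graph n
BS n k = record { adj = bsAdj k ; sym = symP ; irrefl = irr }
  where
  open import Data.Bool.Properties using (∨-comm)
  open import Relation.Binary.PropositionalEquality using (cong₂; cong)
  eqS : ∀ (x y : Fin n) → (x == y) ≡ (y == x)
  eqS x y = helper (toℕ x) (toℕ y)
    where
    helper : ∀ a b → (a ≡ᵇ b) ≡ (b ≡ᵇ a)
    helper zero zero = Relation.Binary.PropositionalEquality.refl
    helper zero (suc b) = Relation.Binary.PropositionalEquality.refl
    helper (suc a) zero = Relation.Binary.PropositionalEquality.refl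
    helper (suc a) (suc b) = helper a b
  symP : ∀ x y → bsAdj k x y ≡ bsAdj k y x
  symP x y = cong₂ _∧_ (cong not (eqS x y)) (∨-comm (bsAdjℕ k (toℕ x) (toℕ y)) _)
  irr : ∀ x → bsAdj k x x ≡ false
  irr x with toℕ x ≡ᵇ toℕ x | ≡⇒≡ᵇ (toℕ x) (toℕ x) Relation.Binary.PropositionalEquality.refl
  ... | true | _ = Relation.Binary.PropositionalEquality.refl

{-# OPTIONS --safe #-}
-- For every D, the balanced spider maximises the number of pairs of vertices at
-- distance at most D; by Abel summation it maximises the Harary index, and equality
-- there forces equality for every D.
--
-- Contract an edge uv of a tree with n vertices and k leaves. If αᵢ and βⱼ count the
-- vertices at distance i from u, resp. j from v, on their sides of uv, then the number
-- of pairs at distance at most D drops by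
--   1 + Σ_{i+j=D; i,j≥1} (αᵢ + βⱼ - αᵢβⱼ).
-- If the sides have p and q leaves, αᵢ ≤ p, βⱼ ≤ q, and a summand exceeds 1 only when one
-- of its factors vanishes. So if both sides have height at least a, the drop is at most
-- D + (k - 2)(D ∸ (a + 1)); it is also at most n - 1. With a + 1 = ⌈(n - 1)/k⌉ such an
-- edge is found at the centre of the tree, where the two heights differ by at most one,
-- and shortening a longest leg of the balanced spider attains the smaller of the two
-- bounds. Equality for D = 2 and D = 2a + 1 forces one side to be a path and the other a
-- spider with legs of a or a + 1 vertices. The contracted tree still has k leaves, so
-- induction on n applies, starting from the star.
module Submission where

open import Defs renaming (sym to adj-sym; irrefl to adj-irrefl)
open import Algebra.Bundles using (CommutativeMonoid)
open import Data.Bool using (Bool; true; false; _∧_; _∨_; not; if_then_else_)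
import Data.Bool
open import Data.Bool.Properties using (∧-comm; ∨-zeroʳ; T-≡)
open import Data.Fin using (Fin; toℕ; fromℕ<; zero; suc; _↑ˡ_; _↑ʳ_)
import Data.Fin
open import Data.Fin.Permutation using (↔⇒≡)
open import Data.Fin.Properties using (+↔⊎; any?; injective⇒≤; splitAt-↑ˡ; splitAt-↑ʳ; toℕ-fromℕ<; toℕ-injective; toℕ<n)
import Data.Integer as ℤ
open import Data.List using (List; []; _∷_; _++_; allFin; filter; foldr; length; map; replicate; tabulate)
open import Data.List.Properties using (++-identityʳ; length-++; length-replicate; map-tabulate)
open import Data.List.Relation.Binary.Permutation.Propositional as ↭ using (_↭_)
open import Data.List.Relation.Binary.Permutation.Propositional.Properties using (shift; ↭-length)
open import Data.List.Relation.Unary.All using (All; []; _∷_)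
open import Data.List.Relation.Unary.All.Properties using (++⁺; replicate⁺)
open import Data.Nat using (ℕ; zero; suc; pred; _+_; _*_; _∸_; _⊔_; _≤_; _<_; _≤?_; _<?_; _≡ᵇ_; _≤ᵇ_; _<ᵇ_; z≤n; s≤s; s≤s⁻¹; NonZero)
import Data.Nat
open import Data.Nat.DivMod using (_/_; _%_; [m+kn]%n≡m%n; m%n<n; m<n⇒m%n≡m; m≡m%n+[m/n]*n; m≥n⇒m/n>0)
import Data.Nat.ListAction as ListAction
open import Data.Nat.Properties
open import Data.Nat.Tactic.RingSolver using (solve-∀)
open import Data.Product using (_×_; _,_; ∃-syntax; proj₁; proj₂)
open import Data.Rational as ℚ using (ℚ; 0ℚ)
import Data.Rational.Properties as ℚ
import Data.Rational.Unnormalised as ℚᵘ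
import Data.Rational.Unnormalised.Properties as ℚᵘ
open import Data.Sum using (_⊎_; inj₁; inj₂)
open import Data.Sum.Function.Propositional using (_⊎-↔_)
open import Function using (_∘_; _↔_; mk↔ₛ′; Equivalence; Inverse)
open import Function.Construct.Composition using (_↔-∘_)
open import Function.Construct.Identity using (↔-id)
open import Function.Construct.Symmetry using (↔-sym)
open import Relation.Binary.PropositionalEquality using (_≡_; refl; sym; trans; cong; cong₂; subst; subst₂; module ≡-Reasoning)
open import Relation.Nullary using (¬_; ¬?; Dec; does; yes; no; contradiction)
open import Algebra.Properties.CommutativeMonoid.Sum +-0-commutativeMonoid using (sum; sum-cong-≗; sum-permute; ∑-comm; ∑-distrib-+)
open Inverse using (to; from; strictlyInverseˡ; strictlyInverseʳ)

-- Sums and convolutions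

-- Fixing D is what lets the induction close: a contraction changes a single count by an explicit
-- amount, whereas the Harary index mixes all distances. The comparison needs an edge with two tall
-- sides, since a small a makes the bound (k - 2)(D ∸ (a + 1)) too weak. A central edge has them for
-- reasons of size: no level of a side holds more vertices than that side has leaves, so low sides
-- could not accommodate n vertices.
--
-- The value D = 2a + 1 is where the two bounds change places. There the first one is ka + 1, at
-- most n - 1; at D = 2a + 2 it is k(a + 1), at least n - 1. So 2a + 1 is the last D governed by the
-- first bound, and the one that says most about the levels of the two sides.
--
-- Uniqueness is not carried through the induction. The contracted tree enters only through the
-- inequality for smaller trees; if t attains the maximum, the drop itself is maximal, and this
-- determines both sides of the contracted edge.

S : (ℕ → ℕ) → ℕ → ℕ
S f zero    = 0
S f (suc n) = S f n + f n

S-start : ∀ f n → S f (suc n) ≡ f 0 + S (f ∘ suc) n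
S-start f zero    = +-comm 0 (f 0)
S-start f (suc n) = trans (cong (_+ f (suc n)) (S-start f n)) (+-assoc (f 0) _ _)

S-mono : ∀ {f g} n → (∀ i → i < n → f i ≤ g i) → S f n ≤ S g n
S-mono zero    e = z≤n
S-mono (suc n) e = +-mono-≤ (S-mono n (λ i i<n → e i (m<n⇒m<1+n i<n))) (e n ≤-refl)

S-+ : ∀ f g n → S (λ i → f i + g i) n ≡ S f n + S g n
S-+ f g zero    = refl
S-+ f g (suc n) = trans (cong (_+ (f n + g n)) (S-+ f g n)) (lem (S f n) (S g n) (f n) (g n))
  where
  lem : ∀ a b c d → a + b + (c + d) ≡ a + c + (b + d)
  lem = solve-∀

S-const : ∀ c n → S (λ _ → c) n ≡ n * c
S-const c zero    = refl
S-const c (suc n) = trans (cong (_+ c) (S-const c n)) (+-comm (n * c) c)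

S-scale : ∀ c f n → S (λ i → c * f i) n ≡ c * S f n
S-scale c f zero    = sym (*-zeroʳ c)
S-scale c f (suc n) = trans (cong (_+ c * f n) (S-scale c f n)) (sym (*-distribˡ-+ c (S f n) (f n)))

S-reverse : ∀ f n → S (λ i → f (n ∸ suc i)) n ≡ S f n
S-reverse f zero    = refl
S-reverse f (suc n) = begin
  S (λ i → f (suc n ∸ suc i)) (suc n)  ≡⟨ S-start (λ i → f (suc n ∸ suc i)) n ⟩
  f n + S (λ i → f (n ∸ suc i)) n      ≡⟨ cong (f n +_) (S-reverse f n) ⟩
  f n + S f n                          ≡⟨ +-comm (f n) (S f n) ⟩
  S f n + f n                          ∎
  where open ≡-Reasoning

-- An attained bound on a drop is a statement about sums; this converts it into one about every
-- summand.
S-squeeze : ∀ {f g} n → (∀ i → i < n → f i ≤ g i) → S g n ≤ S f n → ∀ i → i < n → f i ≡ g i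
S-squeeze {f} {g} (suc n) f≤g Sg≤Sf i i<n with m≤n⇒m<n∨m≡n (s≤s⁻¹ i<n)
  where open import Data.Nat using (s≤s⁻¹)
... | inj₁ i<n′ = S-squeeze n (λ j j<n → f≤g j (m<n⇒m<1+n j<n))
        (+-cancelʳ-≤ (f n) _ _ (≤-trans (+-monoʳ-≤ (S g n) (f≤g n ≤-refl)) Sg≤Sf)) i i<n′
... | inj₂ refl = ≤-antisym (f≤g n ≤-refl)
        (+-cancelˡ-≤ (S f n) _ _ (≤-trans (+-monoˡ-≤ (g n) (S-mono n (λ j j<n → f≤g j (m<n⇒m<1+n j<n)))) Sg≤Sf))

-- conv f g D = Σ_{i+j<D} f i * g j  and  diag f g d = Σ_{i+j+1=d} f i * g j
conv : (ℕ → ℕ) → (ℕ → ℕ) → ℕ → ℕ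
conv f g zero    = 0
conv f g (suc D) = f 0 * S g (suc D) + conv (f ∘ suc) g D

diag : (ℕ → ℕ) → (ℕ → ℕ) → ℕ → ℕ
diag f g d = S (λ i → f i * g (d ∸ suc i)) d

conv-congˡ : ∀ {f f′} g → (∀ i → f i ≡ f′ i) → ∀ D → conv f g D ≡ conv f′ g D
conv-congˡ g e zero    = refl
conv-congˡ g e (suc D) = cong₂ _+_ (cong (_* S g (suc D)) (e 0)) (conv-congˡ g (e ∘ suc) D)

conv-zeroˡ : ∀ g D → conv (λ _ → 0) g D ≡ 0
conv-zeroˡ g zero    = refl
conv-zeroˡ g (suc D) = conv-zeroˡ g D

conv-zeroʳ : ∀ f D → conv f (λ _ → 0) D ≡ 0
conv-zeroʳ f zero    = refl
conv-zeroʳ f (suc D) = cong₂ _+_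
  (trans (cong (f 0 *_) (trans (S-const 0 (suc D)) (*-zeroʳ D))) (*-zeroʳ (f 0))) (conv-zeroʳ (f ∘ suc) D)

conv-+ˡ : ∀ f f′ g D → conv (λ i → f i + f′ i) g D ≡ conv f g D + conv f′ g D
conv-+ˡ f f′ g zero    = refl
conv-+ˡ f f′ g (suc D) =
  trans (cong ((f 0 + f′ 0) * S g (suc D) +_) (conv-+ˡ (f ∘ suc) (f′ ∘ suc) g D))
        (lem (f 0) (f′ 0) (S g (suc D)) (conv (f ∘ suc) g D) (conv (f′ ∘ suc) g D))
  where
  lem : ∀ a b s x y → (a + b) * s + (x + y) ≡ (a * s + x) + (b * s + y)
  lem = solve-∀

conv-+ʳ : ∀ f g g′ D → conv f (λ i → g i + g′ i) D ≡ conv f g D + conv f g′ D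
conv-+ʳ f g g′ zero    = refl
conv-+ʳ f g g′ (suc D) =
  trans (cong₂ (λ s c → f 0 * s + c) (S-+ g g′ (suc D)) (conv-+ʳ (f ∘ suc) g g′ D))
        (lem (f 0) (S g (suc D)) (S g′ (suc D)) (conv (f ∘ suc) g D) (conv (f ∘ suc) g′ D))
  where
  lem : ∀ a s s′ x y → a * (s + s′) + (x + y) ≡ (a * s + x) + (a * s′ + y)
  lem = solve-∀

-- The recursion of `conv` peels off the first factor. Splitting off the root of the second tree
-- requires peeling off the other one.
conv-startʳ : ∀ f g d → conv f g (suc d) ≡ g 0 * S f (suc d) + conv f (g ∘ suc) d
conv-startʳ f g zero    = lem (f 0) (g 0)
  where
  lem : ∀ a b → a * b + 0 ≡ b * a + 0
  lem = solve-∀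
conv-startʳ f g (suc d) = begin
  f 0 * S g (2 + d) + conv (f ∘ suc) g (suc d)
    ≡⟨ cong₂ (λ s c → f 0 * s + c) (S-start g (suc d)) (conv-startʳ (f ∘ suc) g d) ⟩
  f 0 * (g 0 + S (g ∘ suc) (suc d)) + (g 0 * S (f ∘ suc) (suc d) + conv (f ∘ suc) (g ∘ suc) d)
    ≡⟨ lem (f 0) (g 0) _ _ _ ⟩
  g 0 * (f 0 + S (f ∘ suc) (suc d)) + (f 0 * S (g ∘ suc) (suc d) + conv (f ∘ suc) (g ∘ suc) d)
    ≡⟨ cong (λ s → g 0 * s + conv f (g ∘ suc) (suc d)) (sym (S-start f (suc d))) ⟩
  g 0 * S f (2 + d) + conv f (g ∘ suc) (suc d) ∎
  where
  open ≡-Reasoning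
  lem : ∀ a b s t c → a * (b + s) + (b * t + c) ≡ b * (a + t) + (a * s + c)
  lem = solve-∀

conv-suc : ∀ f g d → conv f g (suc d) ≡ conv f g d + diag f g (suc d)
conv-suc f g zero    = +-comm (f 0 * g 0) 0
conv-suc f g (suc d) = begin
  f 0 * (S g (suc d) + g (suc d)) + conv (f ∘ suc) g (suc d)
    ≡⟨ cong (f 0 * (S g (suc d) + g (suc d)) +_) (conv-suc (f ∘ suc) g d) ⟩
  f 0 * (S g (suc d) + g (suc d)) + (conv (f ∘ suc) g d + diag (f ∘ suc) g (suc d))
    ≡⟨ lem (f 0) (S g (suc d)) (g (suc d)) _ _ ⟩
  conv f g (suc d) + (f 0 * g (suc d) + diag (f ∘ suc) g (suc d))
    ≡⟨ cong (conv f g (suc d) +_) (sym (S-start (λ i → f i * g (suc (suc d) ∸ suc i)) (suc d))) ⟩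
  conv f g (suc d) + diag f g (2 + d) ∎
  where
  open ≡-Reasoning
  lem : ∀ a s t c e → a * (s + t) + (c + e) ≡ (a * s + c) + (a * t + e)
  lem = solve-∀

-- Rooted trees: A ◁ B hangs B as a further child below the root of A, so every
-- occurrence of ◁ is an edge, joining the roots of its two arguments.
infixl 5 _◁_
data Tree : Set where
  •   : Tree
  _◁_ : Tree → Tree → Tree

size : Tree → ℕ
size •       = 1
size (A ◁ B) = size A + size B

height : Tree → ℕ
height •       = 0
height (A ◁ B) = height A ⊔ suc (height B)

level : Tree → ℕ → ℕ
level •       zero    = 1
level •       (suc i) = 0
level (A ◁ B) zero    = level A zero
level (A ◁ B) (suc i) = level A (suc i) + level B i

level⁺ : Tree → ℕ → ℕ
level⁺ A i = level A (suc i)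

-- A childless root counts as a leaf: in A ◁ B both roots carry the connecting edge.
leaves nonRootLeaves : Tree → ℕ
leaves •              = 1
leaves (A ◁ B)        = nonRootLeaves A + leaves B
nonRootLeaves •       = 0
nonRootLeaves (A ◁ B) = nonRootLeaves A + leaves B

-- In `A ◁ B` either root is pendent exactly when it has no child within its own side, which is the
-- convention of `leaves`; a single vertex has degree 0.
pendents : Tree → ℕ
pendents •       = 0
pendents (A ◁ B) = leaves A + leaves B

-- The number of pairs of distinct vertices at distance at most D.
near : Tree → ℕ → ℕ
near •       D = 0
near (A ◁ B) D = near A D + near B D + conv (level A) (level B) D

-- The contraction of the edge A ◁ B.
merge : Tree → Tree → Tree
merge A •       = A
merge A (B ◁ C) = merge A B ◁ C

-- Level counts and contraction

level-zero : ∀ A → level A 0 ≡ 1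
level-zero •       = refl
level-zero (A ◁ B) = level-zero A

level-pos : ∀ A {i} → i ≤ height A → 1 ≤ level A i
level-pos A       {zero}  _ = ≤-reflexive (sym (level-zero A))
level-pos (A ◁ B) {suc i} i≤h with suc i ≤? height A
... | yes i≤hA = ≤-trans (level-pos A i≤hA) (m≤m+n _ _)
... | no  i≰hA with suc i ≤? suc (height B)
...   | yes i≤hB = ≤-trans (level-pos B (s≤s⁻¹ i≤hB)) (m≤n+m _ _)
...   | no  i≰hB = contradiction i≤h (<⇒≱ (⊔-lub (≰⇒> i≰hA) (≰⇒> i≰hB)))

level-above : ∀ A {i} → height A < i → level A i ≡ 0
level-above •       {suc i} _   = refl
level-above (A ◁ B) {suc i} h<i = cong₂ _+_
  (level-above A (≤-<-trans (m≤m⊔n _ _) h<i))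
  (level-above B (s≤s⁻¹ (≤-<-trans (m≤n⊔m (height A) _) h<i)))

leaves-pos : ∀ A → 1 ≤ leaves A
leaves-pos •       = ≤-refl
leaves-pos (A ◁ B) = ≤-trans (leaves-pos B) (m≤n+m _ _)

nonRootLeaves≤leaves : ∀ A → nonRootLeaves A ≤ leaves A
nonRootLeaves≤leaves •       = z≤n
nonRootLeaves≤leaves (A ◁ B) = ≤-refl

-- Distinct vertices of equal depth have disjoint subtrees below them, each containing a leaf.
level⁺≤nonRootLeaves : ∀ A i → level⁺ A i ≤ nonRootLeaves A
level≤leaves : ∀ A i → level A i ≤ leaves A
level⁺≤nonRootLeaves •       i = z≤n
level⁺≤nonRootLeaves (A ◁ B) i = +-mono-≤ (level⁺≤nonRootLeaves A i) (level≤leaves B i)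
level≤leaves A zero    = subst (_≤ leaves A) (sym (level-zero A)) (leaves-pos A)
level≤leaves A (suc i) = ≤-trans (level⁺≤nonRootLeaves A i) (nonRootLeaves≤leaves A)

S-level-◁ : ∀ A B d → S (level (A ◁ B)) (suc d) ≡ S (level A) (suc d) + S (level B) d
S-level-◁ A B d = begin
  S (level (A ◁ B)) (suc d)                      ≡⟨ S-start (level (A ◁ B)) d ⟩
  level A 0 + S (λ i → level⁺ A i + level B i) d ≡⟨ cong (level A 0 +_) (S-+ (level⁺ A) (level B) d) ⟩
  level A 0 + (S (level⁺ A) d + S (level B) d)   ≡⟨ sym (+-assoc (level A 0) _ _) ⟩
  level A 0 + S (level⁺ A) d + S (level B) d     ≡⟨ cong (_+ S (level B) d) (sym (S-start (level A) d)) ⟩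
  S (level A) (suc d) + S (level B) d            ∎
  where open ≡-Reasoning

S-level≤size : ∀ A d → S (level A) d ≤ size A
S-level≤size A       zero    = z≤n
S-level≤size •       (suc d) = ≤-reflexive (trans (S-start (level •) d) (cong suc (trans (S-const 0 d) (*-zeroʳ d))))
S-level≤size (A ◁ B) (suc d) rewrite S-level-◁ A B d = +-mono-≤ (S-level≤size A (suc d)) (S-level≤size B d)

S-level≡size : ∀ A {d} → height A < d → S (level A) d ≡ size A
S-level≡size •       {suc d} _   = trans (S-start (level •) d) (cong suc (trans (S-const 0 d) (*-zeroʳ d)))
S-level≡size (A ◁ B) {suc d} h<d = trans (S-level-◁ A B d) (cong₂ _+_
  (S-level≡size A (≤-<-trans (m≤m⊔n _ _) h<d))
  (S-level≡size B (s≤s⁻¹ (≤-<-trans (m≤n⊔m (height A) _) h<d))))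

S-level-suc : ∀ A d → S (level A) (suc d) ≡ suc (S (level⁺ A) d)
S-level-suc A d = trans (S-start (level A) d) (cong (_+ S (level⁺ A) d) (level-zero A))

size≤ : ∀ A → size A ≤ suc (height A * leaves A)
size≤ A = begin
  size A                                ≡⟨ sym (S-level≡size A ≤-refl) ⟩
  S (level A) (suc (height A))          ≡⟨ S-level-suc A (height A) ⟩
  suc (S (level⁺ A) (height A))         ≤⟨ s≤s (S-mono (height A) (λ i _ → level≤leaves A (suc i))) ⟩
  suc (S (λ _ → leaves A) (height A))   ≡⟨ cong suc (S-const (leaves A) (height A)) ⟩
  suc (height A * leaves A)             ∎
  where open ≤-Reasoning

size-merge : ∀ A B → suc (size (merge A B)) ≡ size A + size B
size-merge A •       = +-comm 1 (size A)
size-merge A (B ◁ C) = trans (cong (_+ size C) (size-merge A B)) (+-assoc (size A) (size B) (size C))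

nonRootLeaves-merge : ∀ A B → nonRootLeaves (merge A B) ≡ nonRootLeaves A + nonRootLeaves B
nonRootLeaves-merge A •       = sym (+-identityʳ _)
nonRootLeaves-merge A (B ◁ C) = trans (cong (_+ leaves C) (nonRootLeaves-merge A B)) (+-assoc (nonRootLeaves A) _ _)

leaves-merge : ∀ A B → 1 ≤ height A → leaves (merge A B) ≡ nonRootLeaves A + nonRootLeaves B
leaves-merge (A ◁ C) •       _  = sym (+-identityʳ _)
leaves-merge A       (B ◁ C) _  = nonRootLeaves-merge A (B ◁ C)

-- If both ends of the contracted edge have further neighbours, neither they nor the merged vertex
-- are pendent, so the contraction keeps the number of pendent vertices.
pendents-merge : ∀ A B → 1 ≤ height A → 1 ≤ height B → pendents (merge A B) ≡ leaves A + leaves B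
pendents-merge (A ◁ C) (B ◁ E) 1≤A _ =
  trans (cong (_+ leaves E) (leaves-merge (A ◁ C) B 1≤A)) (+-assoc (leaves (A ◁ C)) _ _)

level⁺-merge : ∀ A B i → level⁺ (merge A B) i ≡ level⁺ A i + level⁺ B i
level⁺-merge A •       i = sym (+-identityʳ _)
level⁺-merge A (B ◁ C) i = trans (cong (_+ level C i) (level⁺-merge A B i)) (+-assoc (level⁺ A i) _ _)

conv-level : ∀ A g d → conv (level A) g (suc d) ≡ S g (suc d) + conv (level⁺ A) g d
conv-level A g d = cong (_+ conv (level⁺ A) g d)
  (trans (cong (_* S g (suc d)) (level-zero A)) (*-identityˡ _))

-- Non-root vertices at depths i + 1 and j + 1 on the two sides are at distance i + j + 2 through
-- the merged vertex; pairs involving that vertex are already counted within one side.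
near-merge : ∀ A B d → near (merge A B) (suc d) ≡ near A (suc d) + near B (suc d) + conv (level⁺ A) (level⁺ B) d
near-merge A •       d = sym (trans (cong (near A (suc d) + 0 +_) (conv-zeroʳ (level⁺ A) d))
    (trans (+-identityʳ _) (+-identityʳ _)))
near-merge A (B ◁ C) d = begin
  near (merge A B) (suc d) + near C (suc d) + conv (level (merge A B)) (level C) (suc d)
    ≡⟨ cong₂ (λ x y → x + near C (suc d) + y) (near-merge A B d)
         (trans (conv-level (merge A B) (level C) d)
           (cong (S (level C) (suc d) +_)
             (trans (conv-congˡ (level C) (level⁺-merge A B) d) (conv-+ˡ (level⁺ A) (level⁺ B) (level C) d)))) ⟩
  near A (suc d) + near B (suc d) + conv (level⁺ A) (level⁺ B) d + near C (suc d)
    + (S (level C) (suc d) + (conv (level⁺ A) (level C) d + conv (level⁺ B) (level C) d))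
    ≡⟨ lem (near A (suc d)) (near B (suc d)) (near C (suc d)) (conv (level⁺ A) (level⁺ B) d)
           (S (level C) (suc d)) (conv (level⁺ A) (level C) d) (conv (level⁺ B) (level C) d) ⟩
  near A (suc d) + (near B (suc d) + near C (suc d) + (S (level C) (suc d) + conv (level⁺ B) (level C) d))
    + (conv (level⁺ A) (level⁺ B) d + conv (level⁺ A) (level C) d)
    ≡⟨ cong₂ (λ x y → near A (suc d) + (near B (suc d) + near C (suc d) + x) + y)
         (sym (conv-level B (level C) d)) (sym (conv-+ʳ (level⁺ A) (level⁺ B) (level C) d)) ⟩
  near A (suc d) + near (B ◁ C) (suc d) + conv (level⁺ A) (level⁺ (B ◁ C)) d ∎
  where
  open ≡-Reasoning
  lem : ∀ a b c x s y z → a + b + x + c + (s + (y + z)) ≡ a + (b + c + (s + z)) + (x + y)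
  lem = solve-∀

-- For D = `suc d` the contraction loses the close pairs across the edge that contain one of the two
-- roots, and gains the pairs of non-root vertices across it whose distance was D + 1. The gain
-- `diag` stands on the left because it may exceed the loss and `∸` would truncate.
near-contract : ∀ A B d → near (A ◁ B) (suc d) + diag (level⁺ A) (level⁺ B) d
  ≡ near (merge A B) (suc d) + suc (S (level⁺ A) d + S (level⁺ B) d)
near-contract A B d = begin
  near A (suc d) + near B (suc d) + conv (level A) (level B) (suc d) + diag (level⁺ A) (level⁺ B) d
    ≡⟨ +-assoc (near A (suc d) + near B (suc d)) _ _ ⟩
  near A (suc d) + near B (suc d) + (conv (level A) (level B) (suc d) + diag (level⁺ A) (level⁺ B) d)
    ≡⟨ cong (near A (suc d) + near B (suc d) +_) (cross d) ⟩
  near A (suc d) + near B (suc d) + (conv (level⁺ A) (level⁺ B) d + suc (S (level⁺ A) d + S (level⁺ B) d))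
    ≡⟨ sym (+-assoc (near A (suc d) + near B (suc d)) _ _) ⟩
  near A (suc d) + near B (suc d) + conv (level⁺ A) (level⁺ B) d + suc (S (level⁺ A) d + S (level⁺ B) d)
    ≡⟨ cong (_+ suc (S (level⁺ A) d + S (level⁺ B) d)) (sym (near-merge A B d)) ⟩
  near (merge A B) (suc d) + suc (S (level⁺ A) d + S (level⁺ B) d) ∎
  where
  open ≡-Reasoning
  cross : ∀ d → conv (level A) (level B) (suc d) + diag (level⁺ A) (level⁺ B) d
        ≡ conv (level⁺ A) (level⁺ B) d + suc (S (level⁺ A) d + S (level⁺ B) d)
  cross zero rewrite level-zero A | level-zero B = refl
  cross (suc e) = begin
    conv (level A) (level B) (2 + e) + diag (level⁺ A) (level⁺ B) (suc e)
      ≡⟨ cong (_+ diag (level⁺ A) (level⁺ B) (suc e)) (trans (conv-level A (level B) (suc e))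
           (cong₂ _+_ (S-level-suc B (suc e)) (conv-startʳ (level⁺ A) (level B) e))) ⟩
    suc (S (level⁺ B) (suc e)) + (level B 0 * S (level⁺ A) (suc e) + conv (level⁺ A) (level⁺ B) e)
      + diag (level⁺ A) (level⁺ B) (suc e)
      ≡⟨ cong (λ x → suc (S (level⁺ B) (suc e)) + (x * S (level⁺ A) (suc e) + conv (level⁺ A) (level⁺ B) e)
           + diag (level⁺ A) (level⁺ B) (suc e)) (level-zero B) ⟩
    suc (S (level⁺ B) (suc e)) + (1 * S (level⁺ A) (suc e) + conv (level⁺ A) (level⁺ B) e)
      + diag (level⁺ A) (level⁺ B) (suc e)
      ≡⟨ lem (S (level⁺ B) (suc e)) (S (level⁺ A) (suc e)) _ _ ⟩
    conv (level⁺ A) (level⁺ B) e + diag (level⁺ A) (level⁺ B) (suc e)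
      + suc (S (level⁺ A) (suc e) + S (level⁺ B) (suc e))
      ≡⟨ cong (_+ suc (S (level⁺ A) (suc e) + S (level⁺ B) (suc e))) (sym (conv-suc (level⁺ A) (level⁺ B) e)) ⟩
    conv (level⁺ A) (level⁺ B) (suc e) + suc (S (level⁺ A) (suc e) + S (level⁺ B) (suc e)) ∎
    where
    lem : ∀ b a c x → suc b + (1 * a + c) + x ≡ c + x + suc (a + b)
    lem = solve-∀

-- Upper bound for a contraction; spiders

isZero : ℕ → ℕ
isZero zero    = 1
isZero (suc _) = 0

-- A tree has no empty level up to its height and only empty ones above, so this counts the empty
-- levels among 1, ..., d.
S-isZero : ∀ A d → S (isZero ∘ level⁺ A) d ≡ d ∸ height A
S-isZero A zero    = sym (0∸n≡0 (height A))
S-isZero A (suc d) with height A ≤? d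
... | yes h≤d rewrite level-above A (s≤s h≤d) | S-isZero A d = begin
  d ∸ height A + 1  ≡⟨ +-comm _ 1 ⟩
  suc (d ∸ height A) ≡⟨ sym (+-∸-assoc 1 h≤d) ⟩
  suc d ∸ height A   ∎
  where open ≡-Reasoning
... | no  h≰d with level⁺ A d | level-pos A (≰⇒> h≰d)
...   | suc _ | _ rewrite S-isZero A d | m≤n⇒m∸n≡0 (≰⇒> h≰d) | m≤n⇒m∸n≡0 (<⇒≤ (≰⇒> h≰d)) = refl

contractBound : ℕ → ℕ → ℕ → ℕ → ℕ
contractBound p q x y = x * y + (1 + (p * isZero y + q * isZero x))

-- If neither number vanishes this is (x - 1)(y - 1) ≥ 0. If one vanishes, the indicator attached to
-- it pays for the whole of the other.
+≤contractBound : ∀ p q x y → x ≤ suc p → y ≤ suc q → x + y ≤ contractBound p q x y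
+≤contractBound p q zero y _ y≤q = begin
  y                              ≤⟨ y≤q ⟩
  suc q                          ≡⟨ cong suc (sym (*-identityʳ q)) ⟩
  suc (q * 1)                    ≤⟨ s≤s (m≤n+m _ _) ⟩
  1 + (p * isZero y + q * 1)     ∎
  where open ≤-Reasoning
+≤contractBound p q (suc x) zero x≤p _ rewrite +-identityʳ x | *-zeroʳ x | *-identityʳ p =
  ≤-trans x≤p (s≤s (m≤m+n _ _))
+≤contractBound p q (suc x) (suc y) _ _ = ≤-trans (m≤m+n _ (x * y))
  (≤-trans (≤-reflexive (lem x y)) (+-monoʳ-≤ (suc x * suc y) (m≤m+n 1 (p * 0 + q * 0))))
  where
  lem : ∀ x y → suc x + suc y + x * y ≡ suc x * suc y + 1
  lem = solve-∀

-- Along the antidiagonal the levels of B occur in reverse order, which does not affect the number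
-- of empty ones.
S-contractBound : ∀ p q A B d →
  S (λ i → contractBound p q (level⁺ A i) (level⁺ B (d ∸ suc i))) d
  ≡ diag (level⁺ A) (level⁺ B) d + (d + (p * (d ∸ height B) + q * (d ∸ height A)))
S-contractBound p q A B d = begin
  S (λ i → contractBound p q (α i) (β i)) d
    ≡⟨ S-+ (λ i → α i * β i) (λ i → 1 + (p * isZero (β i) + q * isZero (α i))) d ⟩
  D + S (λ i → 1 + (p * isZero (β i) + q * isZero (α i))) d
    ≡⟨ cong (D +_) (S-+ (λ _ → 1) (λ i → p * isZero (β i) + q * isZero (α i)) d) ⟩
  D + (S (λ _ → 1) d + S (λ i → p * isZero (β i) + q * isZero (α i)) d)
    ≡⟨ cong (D +_) (cong₂ _+_ (trans (S-const 1 d) (*-identityʳ d))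
         (S-+ (λ i → p * isZero (β i)) (λ i → q * isZero (α i)) d)) ⟩
  D + (d + (S (λ i → p * isZero (β i)) d + S (λ i → q * isZero (α i)) d))
    ≡⟨ cong (λ x → D + (d + x)) (cong₂ _+_
         (trans (S-scale p (isZero ∘ β) d) (cong (p *_) (trans (S-reverse (isZero ∘ level⁺ B) d) (S-isZero B d))))
         (trans (S-scale q (isZero ∘ α) d) (cong (q *_) (S-isZero A d)))) ⟩
  D + (d + (p * (d ∸ height B) + q * (d ∸ height A))) ∎
  where
  open ≡-Reasoning
  α = level⁺ A
  β = λ i → level⁺ B (d ∸ suc i)
  D = diag (level⁺ A) (level⁺ B) d

S-levels : ∀ A B d → S (λ i → level⁺ A i + level⁺ B (d ∸ suc i)) d ≡ S (level⁺ A) d + S (level⁺ B) d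
S-levels A B d = trans (S-+ (level⁺ A) _ d) (cong (S (level⁺ A) d +_) (S-reverse (level⁺ B) d))

levels≤contractBound : ∀ {p q} A B → leaves A ≡ suc p → leaves B ≡ suc q → ∀ d i →
  level⁺ A i + level⁺ B (d ∸ suc i) ≤ contractBound p q (level⁺ A i) (level⁺ B (d ∸ suc i))
levels≤contractBound {p} {q} A B lA lB d i = +≤contractBound p q _ _
  (subst (level⁺ A i ≤_) lA (level≤leaves A (suc i)))
  (subst (level⁺ B (d ∸ suc i) ≤_) lB (level≤leaves B _))

∸-heights≤ : ∀ p q A B {a} d → a ≤ height A → a ≤ height B →
  p * (d ∸ height B) + q * (d ∸ height A) ≤ (p + q) * (d ∸ a)
∸-heights≤ p q A B {a} d a≤A a≤B = ≤-trans
  (+-mono-≤ (*-monoʳ-≤ p (∸-monoʳ-≤ d a≤B)) (*-monoʳ-≤ q (∸-monoʳ-≤ d a≤A)))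
  (≤-reflexive (sym (*-distribʳ-+ (d ∸ a) p q)))

-- With p + 1 and q + 1 leaves on the two sides, p + q is k - 2. The products occur in the exact
-- formula and in the summed bound alike, so `diag` cancels.
near-contract-≤ : ∀ {p q a} A B → leaves A ≡ suc p → leaves B ≡ suc q → a ≤ height A → a ≤ height B →
  ∀ d → near (A ◁ B) (suc d) ≤ near (merge A B) (suc d) + suc (d + (p + q) * (d ∸ a))
near-contract-≤ {p} {q} {a} A B lA lB a≤A a≤B d = +-cancelʳ-≤ D _ _ (begin
  near (A ◁ B) (suc d) + D
    ≡⟨ near-contract A B d ⟩
  M + suc (S (level⁺ A) d + S (level⁺ B) d)
    ≡⟨ cong (λ x → M + suc x) (sym (S-levels A B d)) ⟩
  M + suc (S (λ i → level⁺ A i + level⁺ B (d ∸ suc i)) d)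
    ≤⟨ +-monoʳ-≤ M (s≤s (S-mono d (λ i _ → levels≤contractBound A B lA lB d i))) ⟩
  M + suc (S (λ i → contractBound p q (level⁺ A i) (level⁺ B (d ∸ suc i))) d)
    ≡⟨ cong (λ x → M + suc x) (S-contractBound p q A B d) ⟩
  M + suc (D + (d + (p * (d ∸ height B) + q * (d ∸ height A))))
    ≤⟨ +-monoʳ-≤ M (s≤s (+-monoʳ-≤ D (+-monoʳ-≤ d (∸-heights≤ p q A B d a≤A a≤B)))) ⟩
  M + suc (D + (d + (p + q) * (d ∸ a)))
    ≡⟨ lem M D (d + (p + q) * (d ∸ a)) ⟩
  M + suc (d + (p + q) * (d ∸ a)) + D ∎)
  where
  open ≤-Reasoning
  D = diag (level⁺ A) (level⁺ B) d
  M = near (merge A B) (suc d)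
  lem : ∀ m x y → m + suc (x + y) ≡ m + suc y + x
  lem = solve-∀

-- The gain is ignored: the pairs across the edge containing one of its ends number only 1 + (size A
-- - 1) + (size B - 1) = N.
near-contract-≤-size : ∀ {N} A B → size A + size B ≡ suc N →
  ∀ d → near (A ◁ B) (suc d) ≤ near (merge A B) (suc d) + N
near-contract-≤-size {N} A B eq d = begin
  near (A ◁ B) (suc d)                                             ≤⟨ m≤m+n _ _ ⟩
  near (A ◁ B) (suc d) + diag (level⁺ A) (level⁺ B) d              ≡⟨ near-contract A B d ⟩
  near (merge A B) (suc d) + suc (S (level⁺ A) d + S (level⁺ B) d) ≤⟨ +-monoʳ-≤ (near (merge A B) (suc d)) (s≤s⁻¹ bound) ⟩
  near (merge A B) (suc d) + N                                     ∎
  where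
  open ≤-Reasoning
  bound : 2 + (S (level⁺ A) d + S (level⁺ B) d) ≤ suc N
  bound = begin
    2 + (S (level⁺ A) d + S (level⁺ B) d)       ≡⟨ cong suc (sym (+-suc _ _)) ⟩
    suc (S (level⁺ A) d) + suc (S (level⁺ B) d) ≡⟨ sym (cong₂ _+_ (S-level-suc A d) (S-level-suc B d)) ⟩
    S (level A) (suc d) + S (level B) (suc d)   ≤⟨ +-mono-≤ (S-level≤size A (suc d)) (S-level≤size B (suc d)) ⟩
    size A + size B                             ≡⟨ eq ⟩
    suc N                                       ∎

-- A path with m + 1 vertices rooted at an end; in a spider, the entry m stands
-- for a leg with m + 1 vertices.
chain : ℕ → Tree
chain zero    = •
chain (suc m) = • ◁ chain m

spider : List ℕ → Tree
spider []      = •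
spider (m ∷ L) = spider L ◁ chain m

height-chain : ∀ m → height (chain m) ≡ m
height-chain zero    = refl
height-chain (suc m) = cong suc (height-chain m)

leaves-chain : ∀ m → leaves (chain m) ≡ 1
leaves-chain zero    = refl
leaves-chain (suc m) = leaves-chain m

size-chain : ∀ m → size (chain m) ≡ suc m
size-chain zero    = refl
size-chain (suc m) = cong suc (size-chain m)

level-chain : ∀ {m i} → i ≤ m → level (chain m) i ≡ 1
level-chain {m} {i} i≤m = ≤-antisym
  (subst (level (chain m) i ≤_) (leaves-chain m) (level≤leaves (chain m) i))
  (level-pos (chain m) (subst (i ≤_) (sym (height-chain m)) i≤m))

level-chain-above : ∀ {m i} → m < i → level (chain m) i ≡ 0
level-chain-above {m} {i} m<i = level-above (chain m) (subst (_< i) (sym (height-chain m)) m<i)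

leaves≡1⇒chain : ∀ A → leaves A ≡ 1 → A ≡ chain (height A)
leaves≡1⇒chain •             _  = refl
leaves≡1⇒chain (• ◁ B)       eq = cong (• ◁_) (leaves≡1⇒chain B eq)
leaves≡1⇒chain (A ◁ C ◁ B) eq = contradiction eq (<⇒≢ (begin-strict
  1                                     <⟨ +-mono-≤ (leaves-pos C) (leaves-pos B) ⟩
  leaves C + leaves B                   ≤⟨ +-monoˡ-≤ (leaves B) (m≤n+m _ _) ⟩
  nonRootLeaves A + leaves C + leaves B ∎) ∘ sym)
  where open ≤-Reasoning

-- As an entry m is a leg of m + 1 vertices, this means legs of a or a + 1 vertices for a = b + 1.
Within : ℕ → ℕ → Set
Within b m = b ≤ m × m ≤ suc b

nonRootLeaves-spider : ∀ L → nonRootLeaves (spider L) ≡ length L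
nonRootLeaves-spider []      = refl
nonRootLeaves-spider (m ∷ L) rewrite nonRootLeaves-spider L | leaves-chain m = +-comm _ 1

height-spider : ∀ {b L} → All (Within b) L → height (spider L) ≤ 2 + b
height-spider []                       = z≤n
height-spider (_∷_ {m} (_ , m≤b) all) =
  ⊔-lub (height-spider all) (s≤s (subst (_≤ _) (sym (height-chain m)) m≤b))

level⁺-spider : ∀ {b L i} → i ≤ b → All (Within b) L → level⁺ (spider L) i ≡ length L
level⁺-spider i≤b []                = refl
level⁺-spider i≤b ((b≤m , _) ∷ all) =
  trans (cong₂ _+_ (level⁺-spider i≤b all) (level-chain (≤-trans i≤b b≤m))) (+-comm _ 1)

-- The subtree at each child of the root has a leaf; if there are no more leaves than children, each
-- has exactly one and is a path.
nonRootLeaves≡level⁺⇒spider : ∀ A → nonRootLeaves A ≤ level⁺ A 0 → ∃[ L ] A ≡ spider L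
nonRootLeaves≡level⁺⇒spider •       _  = [] , refl
nonRootLeaves≡level⁺⇒spider (A ◁ B) le
  with nonRootLeaves≡level⁺⇒spider A (+-cancelʳ-≤ 1 _ _ (begin
         nonRootLeaves A + 1        ≤⟨ +-monoʳ-≤ (nonRootLeaves A) (leaves-pos B) ⟩
         nonRootLeaves A + leaves B ≤⟨ le ⟩
         level⁺ A 0 + level B 0     ≡⟨ cong (level⁺ A 0 +_) (level-zero B) ⟩
         level⁺ A 0 + 1             ∎))
     | leaves≡1⇒chain B (≤-antisym (+-cancelˡ-≤ (level⁺ A 0) _ _ (begin
         level⁺ A 0 + leaves B      ≤⟨ +-monoˡ-≤ (leaves B) (level⁺≤nonRootLeaves A 0) ⟩
         nonRootLeaves A + leaves B ≤⟨ le ⟩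
         level⁺ A 0 + level B 0     ≡⟨ cong (level⁺ A 0 +_) (level-zero B) ⟩
         level⁺ A 0 + 1             ∎)) (leaves-pos B))
  where open ≤-Reasoning
... | L , eqA | eqB = height B ∷ L , cong₂ _◁_ eqA eqB

-- A leg has at most one vertex on each level, so a full count at depth b + 1 means that no leg ends
-- before it.
spider-within : ∀ {b} L → height (spider L) ≤ 2 + b → length L ≤ level⁺ (spider L) b → All (Within b) L
spider-within []      _  _  = []
spider-within {b} (m ∷ L) h≤ le with b ≤? m
... | yes b≤m = (b≤m , s≤s⁻¹ (subst (λ x → suc x ≤ _) (height-chain m) (≤-trans (m≤n⊔m (height (spider L)) _) h≤)))
              ∷ spider-within L (≤-trans (m≤m⊔n _ _) h≤)
                  (s≤s⁻¹ (subst (suc (length L) ≤_) (trans (cong (level⁺ (spider L) b +_) (level-chain b≤m)) (+-comm _ 1)) le))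
... | no  b≰m = contradiction (≤-trans le (begin
        level⁺ (spider L) b + level (chain m) b ≡⟨ cong (level⁺ (spider L) b +_) (level-chain-above (≰⇒> b≰m)) ⟩
        level⁺ (spider L) b + 0                 ≡⟨ +-identityʳ _ ⟩
        level⁺ (spider L) b                     ≤⟨ level⁺≤nonRootLeaves (spider L) b ⟩
        nonRootLeaves (spider L)                ≡⟨ nonRootLeaves-spider L ⟩
        length L                                ∎)) 1+n≰n
  where open ≤-Reasoning

-- When the contraction bound is attained

suc[i]+[d∸suc[i]]≡d : ∀ {i d} → i < d → suc (i + (d ∸ suc i)) ≡ d
suc[i]+[d∸suc[i]]≡d i<d = m+[n∸m]≡n i<d

-- Contracting the first edge of a leg shortens the leg by one. Every summand attains
-- `contractBound`: a level of the chain holds one vertex or none, and for d ≤ 2a an empty one is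
-- always paired with a full level of the spider.
near-contract-spider : ∀ {b m L} → All (Within b) L → length L ≡ suc m → ∀ {d} → d ≤ suc b + suc b →
  near (merge (spider L) (chain (suc b))) (suc d) + suc (d + m * (d ∸ suc b)) ≤ near (spider L ◁ chain (suc b)) (suc d)
near-contract-spider {b} {m} {L} all len {d} d≤2a = +-cancelʳ-≤ D _ _ (begin
  M + suc (d + m * (d ∸ suc b)) + D
    ≡⟨ lem M D d (m * (d ∸ suc b)) ⟩
  M + suc (D + (d + (m * (d ∸ suc b) + 0)))
    ≡⟨ cong (λ x → M + suc (D + (d + (m * (d ∸ x) + 0)))) (sym (height-chain (suc b))) ⟩
  M + suc (D + (d + (m * (d ∸ height B) + 0)))
    ≡⟨ cong (λ x → M + suc x) (sym (S-contractBound m 0 A B d)) ⟩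
  M + suc (S (λ i → contractBound m 0 (level⁺ A i) (level⁺ B (d ∸ suc i))) d)
    ≤⟨ +-monoʳ-≤ M (s≤s (S-mono d pointwise)) ⟩
  M + suc (S (λ i → level⁺ A i + level⁺ B (d ∸ suc i)) d)
    ≡⟨ cong (λ x → M + suc x) (S-levels A B d) ⟩
  M + suc (S (level⁺ A) d + S (level⁺ B) d)
    ≡⟨ sym (near-contract A B d) ⟩
  near (A ◁ B) (suc d) + D ∎)
  where
  open ≤-Reasoning
  A = spider L
  B = chain (suc b)
  D = diag (level⁺ A) (level⁺ B) d
  M = near (merge A B) (suc d)
  lem : ∀ m x d y → m + suc (d + y) + x ≡ m + suc (x + (d + (y + 0)))
  lem = solve-∀
  -- From i + j + 1 = d ≤ 2a and j ≥ a it follows that i < a.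
  i≤b : ∀ {i} → i < d → suc b ≤ d ∸ suc i → i ≤ b
  i≤b {i} i<d a≤j = s≤s⁻¹ (+-cancelʳ-≤ (suc b) (suc i) (suc b) (≤-trans (s≤s (+-monoʳ-≤ i a≤j))
            (≤-trans (≤-reflexive (suc[i]+[d∸suc[i]]≡d i<d)) d≤2a)))
  pointwise : ∀ i → i < d → contractBound m 0 (level⁺ A i) (level⁺ B (d ∸ suc i)) ≤ level⁺ A i + level⁺ B (d ∸ suc i)
  pointwise i i<d with d ∸ suc i <? suc b
  ... | yes j<a rewrite level-chain {suc b} j<a | *-zeroʳ m | *-identityʳ (level⁺ A i) = ≤-refl
  ... | no  j≮a rewrite level-chain-above {suc b} (s≤s (≮⇒≥ j≮a))
                      | level⁺-spider {b} {L} {i} (i≤b i<d (≮⇒≥ j≮a)) all | len | *-zeroʳ m | *-identityʳ m | +-identityʳ m = ≤-refl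

-- For d > 2a nothing is gained: if the chain still has a vertex at depth j + 1 ≤ a, then i > a, and
-- depth i + 1 exceeds the height a + 1 of the spider. Since d is at least both heights, all N pairs
-- are lost.
near-contract-spider-size : ∀ {b N L} → All (Within b) L → size (spider L) + size (chain (suc b)) ≡ suc N →
  ∀ {d} → suc b + suc b < d →
  near (merge (spider L) (chain (suc b))) (suc d) + N ≤ near (spider L ◁ chain (suc b)) (suc d)
near-contract-spider-size {b} {N} {L} all eq {d} 2a<d = ≤-reflexive (begin
  M + N
    ≡⟨ cong (M +_) (suc-injective (trans (sym eq) (sym sizes))) ⟩
  M + suc (S (level⁺ A) d + S (level⁺ B) d)
    ≡⟨ sym (near-contract A B d) ⟩
  near (A ◁ B) (suc d) + diag (level⁺ A) (level⁺ B) d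
    ≡⟨ cong (near (A ◁ B) (suc d) +_) diag≡0 ⟩
  near (A ◁ B) (suc d) + 0
    ≡⟨ +-identityʳ _ ⟩
  near (A ◁ B) (suc d) ∎)
  where
  open ≡-Reasoning
  A = spider L
  B = chain (suc b)
  M = near (merge A B) (suc d)
  a<d : suc b < d
  a<d = ≤-<-trans (m≤m+n (suc b) (suc b)) 2a<d
  sizes : 2 + (S (level⁺ A) d + S (level⁺ B) d) ≡ size A + size B
  sizes = begin
    2 + (S (level⁺ A) d + S (level⁺ B) d)       ≡⟨ cong suc (sym (+-suc _ _)) ⟩
    suc (S (level⁺ A) d) + suc (S (level⁺ B) d) ≡⟨ sym (cong₂ _+_ (S-level-suc A d) (S-level-suc B d)) ⟩
    S (level A) (suc d) + S (level B) (suc d)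
      ≡⟨ cong₂ _+_ (S-level≡size A (s≤s (≤-trans (height-spider all) a<d)))
           (S-level≡size B (s≤s (subst (_≤ d) (sym (height-chain (suc b))) (<⇒≤ a<d)))) ⟩
    size A + size B                             ∎
  a<i : ∀ {i} → i < d → d ∸ suc i < suc b → suc b < i
  a<i {i} i<d j<a = +-cancelʳ-< (suc b) (suc b) i (≤-trans 2a<d
            (≤-trans (≤-reflexive (sym (suc[i]+[d∸suc[i]]≡d i<d)))
              (≤-trans (≤-reflexive (sym (+-suc i _))) (+-monoʳ-≤ i j<a))))
  diag≤0 : ∀ i → i < d → level⁺ A i * level⁺ B (d ∸ suc i) ≤ 0
  diag≤0 i i<d with d ∸ suc i <? suc b
  ... | no  j≮a rewrite level-chain-above {suc b} (s≤s (≮⇒≥ j≮a)) = ≤-reflexive (*-zeroʳ (level⁺ A i))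
  ... | yes j<a rewrite level-above A {suc i} (s≤s (≤-trans (height-spider all) (a<i i<d j<a))) = z≤n
  diag≡0 : diag (level⁺ A) (level⁺ B) d ≡ 0
  diag≡0 = n≤0⇒n≡0 (≤-trans (S-mono d diag≤0) (≤-reflexive (trans (S-const 0 d) (*-zeroʳ d))))

contractBound-zeroʳ : ∀ p q {x y} → x + y ≡ contractBound p q x y → y ≡ 0 → x ≡ suc p
contractBound-zeroʳ p q {suc x} {zero} eq refl = trans (sym (+-identityʳ (suc x))) (trans eq lem)
  where
  lem : contractBound p q (suc x) 0 ≡ suc p
  lem rewrite *-zeroʳ x | *-zeroʳ q | *-identityʳ p = cong suc (+-identityʳ p)

contractBound-zeroˡ : ∀ p q {x y} → x + y ≡ contractBound p q x y → x ≡ 0 → y ≡ suc q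
contractBound-zeroˡ p q {zero} {suc y} eq refl = trans eq lem
  where
  lem : contractBound p q 0 (suc y) ≡ suc q
  lem rewrite *-zeroʳ p | *-identityʳ q = refl

-- The two sides of the contracted edge, when the contraction bound is attained
-- for D = 2 and D = 2a + 1, where a = b + 1.
record SpiderChain (b : ℕ) (A B : Tree) : Set where
  field
    legs   : List ℕ
    spiderˡ : A ≡ spider legs
    chainʳ  : B ≡ chain (suc b)
    legs-within : All (Within b) legs

-- For d = 2a the antidiagonal pairs each level 1, ..., a of one side with a level beyond a of the
-- other. Once the other side has height a, those levels are empty, and equality of the summands
-- fixes the level counts of the first.
module _ {p q b} (A B : Tree) (lA : leaves A ≡ suc p) (lB : leaves B ≡ suc q)
  (a≤B : suc b ≤ height B) (B≤A : height B ≤ height A) (A≤B : height A ≤ suc (height B))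
  (tight : near (merge A B) (suc (suc b + suc b)) + suc (suc b + suc b + (p + q) * suc b)
           ≤ near (A ◁ B) (suc (suc b + suc b)))
  where
  private
    a = suc b
    d = a + a
    D = diag (level⁺ A) (level⁺ B) d
    M = near (merge A B) (suc d)
    F = λ i → level⁺ A i + level⁺ B (d ∸ suc i)
    G = λ i → contractBound p q (level⁺ A i) (level⁺ B (d ∸ suc i))
    a≤A = ≤-trans a≤B B≤A
    d∸a : d ∸ a ≡ a
    d∸a = m+n∸n≡m a a

    sum-F : D + (d + (p + q) * a) ≤ S F d
    sum-F = s≤s⁻¹ (+-cancelˡ-≤ M _ _ (begin
      M + suc (D + (d + (p + q) * a))               ≡⟨ lem M D _ ⟩
      M + suc (d + (p + q) * a) + D                 ≤⟨ +-monoˡ-≤ D tight ⟩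
      near (A ◁ B) (suc d) + D                      ≡⟨ near-contract A B d ⟩
      M + suc (S (level⁺ A) d + S (level⁺ B) d)     ≡⟨ cong (λ x → M + suc x) (sym (S-levels A B d)) ⟩
      M + suc (S F d)                               ∎))
      where
      open ≤-Reasoning
      lem : ∀ m x y → m + suc (x + y) ≡ m + suc y + x
      lem = solve-∀

    F≤G : ∀ i → i < d → F i ≤ G i
    F≤G i _ = levels≤contractBound A B lA lB d i

    F≡G : ∀ i → i < d → F i ≡ G i
    F≡G = S-squeeze d F≤G (begin
      S G d                                                       ≡⟨ S-contractBound p q A B d ⟩
      D + (d + (p * (d ∸ height B) + q * (d ∸ height A)))         ≤⟨ +-monoʳ-≤ D (+-monoʳ-≤ d (∸-heights≤ p q A B d a≤A a≤B)) ⟩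
      D + (d + (p + q) * (d ∸ a))                                 ≡⟨ cong (λ x → D + (d + (p + q) * x)) d∸a ⟩
      D + (d + (p + q) * a)                                       ≤⟨ sum-F ⟩
      S F d                                                       ∎)
      where open ≤-Reasoning

    products : p * a + q * a ≤ p * (d ∸ height B) + q * (d ∸ height A)
    products = +-cancelˡ-≤ d _ _ (+-cancelˡ-≤ D _ _ (begin
      D + (d + (p * a + q * a))                           ≡⟨ cong (λ x → D + (d + x)) (sym (*-distribʳ-+ a p q)) ⟩
      D + (d + (p + q) * a)                               ≤⟨ sum-F ⟩
      S F d                                               ≤⟨ S-mono d F≤G ⟩
      S G d                                               ≡⟨ S-contractBound p q A B d ⟩
      D + (d + (p * (d ∸ height B) + q * (d ∸ height A))) ∎))
      where open ≤-Reasoning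

    ∸height≤a : ∀ T → a ≤ height T → d ∸ height T ≤ a
    ∸height≤a T a≤T = subst (d ∸ height T ≤_) d∸a (∸-monoʳ-≤ d a≤T)

    height≤a : ∀ T → a ≤ d ∸ height T → height T ≤ a
    height≤a T le with height T ≤? d
    ... | yes h≤d = +-cancelʳ-≤ a _ _ (≤-trans (+-monoʳ-≤ (height T) le) (≤-reflexive (m+[n∸m]≡n h≤d)))
    ... | no  h≰d = contradiction (≤-trans le (≤-reflexive (m≤n⇒m∸n≡0 (<⇒≤ (≰⇒> h≰d))))) λ ()

    -- Each `d ∸ height` is at most a, so `products` forces the one with a positive coefficient to
    -- equal a. As d = 2a, that height is then at most a.
    height-B : ∀ {p′} → p ≡ suc p′ → height B ≡ a
    height-B {p′} refl = ≤-antisym (height≤a B (*-cancelˡ-≤ p (+-cancelʳ-≤ (q * a) _ _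
      (≤-trans products (+-monoʳ-≤ (p * (d ∸ height B)) (*-monoʳ-≤ q (∸height≤a A a≤A))))))) a≤B

    height-A : ∀ {q′} → q ≡ suc q′ → height A ≡ a
    height-A {q′} refl = ≤-antisym (height≤a A (*-cancelˡ-≤ q (+-cancelˡ-≤ (p * a) _ _
      (≤-trans products (+-monoˡ-≤ (q * (d ∸ height A)) (*-monoʳ-≤ p (∸height≤a B a≤B))))))) a≤A

    a≤d∸ : ∀ {i} → i < a → a ≤ d ∸ suc i
    a≤d∸ {i} i<a = ≤-trans (≤-reflexive (sym d∸a)) (∸-monoʳ-≤ d i<a)

    i<d : ∀ {i} → i < a → i < d
    i<d i<a = ≤-trans i<a (m≤m+n a a)

    level-A : height B ≡ a → ∀ {i} → i < a → level⁺ A i ≡ suc p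
    level-A hB {i} i<a = contractBound-zeroʳ p q (F≡G i (i<d i<a))
      (level-above B (s≤s (subst (_≤ d ∸ suc i) (sym hB) (a≤d∸ i<a))))

    level-B : height A ≡ a → ∀ {j} → j < a → level⁺ B j ≡ suc q
    level-B hA {j} j<a = trans (cong (level⁺ B) (sym rev))
      (contractBound-zeroˡ p q (F≡G (d ∸ suc j) (∸-monoʳ-< {d} {suc j} {0} (s≤s z≤n) (i<d j<a)))
        (level-above A (s≤s (subst (_≤ d ∸ suc j) (sym hA) (a≤d∸ j<a)))))
      where
      rev : d ∸ suc (d ∸ suc j) ≡ j
      rev = trans (cong (d ∸_) (sym (+-∸-assoc 1 (i<d j<a)))) (m∸[m∸n]≡n (<⇒≤ (i<d j<a)))

    -- Level 1 with as many vertices as X has leaves makes X a spider; level a = b + 1 with as many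
    -- keeps its legs from ending earlier.
    build : ∀ {p} X Y → leaves X ≡ suc p → leaves Y ≡ 1 → height Y ≡ a → height X ≤ suc a →
      (∀ {i} → i < a → level⁺ X i ≡ suc p) → SpiderChain b X Y
    build {p} X Y lX lY hY hX lev
      with nonRootLeaves≡level⁺⇒spider X (≤-trans (nonRootLeaves≤leaves X) (≤-reflexive (trans lX (sym (lev (s≤s z≤n))))))
    ... | L , refl = record
      { legs = L ; spiderˡ = refl
      ; chainʳ = trans (leaves≡1⇒chain Y lY) (cong chain hY)
      ; legs-within = spider-within L hX (begin
          length L                 ≡⟨ sym (nonRootLeaves-spider L) ⟩
          nonRootLeaves (spider L) ≤⟨ nonRootLeaves≤leaves (spider L) ⟩
          leaves (spider L)        ≡⟨ trans lX (sym (lev ≤-refl)) ⟩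
          level⁺ (spider L) b      ∎) }
      where open ≤-Reasoning

  -- A side with a single leaf is the chain. If both sides had more, both roots would have at least
  -- two children, and with α and β children the drop for D = 2 is 2 - (α - 1)(β - 1), less than the
  -- 2 that is attained.
  tight⇒spiderChain : 1 ≤ p + q → near (merge A B) 2 + 2 ≤ near (A ◁ B) 2 →
    SpiderChain b A B ⊎ SpiderChain b B A
  tight⇒spiderChain = go p q refl refl
    where
    go : ∀ p′ q′ → p ≡ p′ → q ≡ q′ → 1 ≤ p + q → near (merge A B) 2 + 2 ≤ near (A ◁ B) 2 →
      SpiderChain b A B ⊎ SpiderChain b B A
    go zero    zero     refl refl () _
    go (suc p′) zero    refl refl _ _ = inj₁ (build A B lA lB hB (subst (λ x → height A ≤ suc x) hB A≤B) (level-A hB))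
      where hB = height-B refl
    go zero    (suc q′) refl refl _ _ = inj₂ (build B A lB lA hA (≤-trans B≤A (≤-trans (≤-reflexive hA) (n≤1+n a))) (level-B hA))
      where hA = height-A refl
    go (suc p′) (suc q′) refl refl _ tight₂ = contradiction
      (+-cancelˡ-≤ (near (merge A B) 2) _ _ (begin
        near (merge A B) 2 + (2 + α * β)                 ≡⟨ sym (+-assoc (near (merge A B) 2) 2 _) ⟩
        near (merge A B) 2 + 2 + α * β                   ≤⟨ +-monoˡ-≤ (α * β) tight₂ ⟩
        near (A ◁ B) 2 + α * β                           ≡⟨ near-contract A B 1 ⟩
        near (merge A B) 2 + suc (α + β)                 ∎))
      (<⇒≱ (subst (λ (x , y) → suc (x + y) < 2 + x * y) (sym (cong₂ _,_ α≡ β≡)) (lem p′ q′)))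
      where
      open ≤-Reasoning
      α = level⁺ A 0
      β = level⁺ B 0
      α≡ : α ≡ suc p
      α≡ = level-A (height-B refl) (s≤s z≤n)
      β≡ : β ≡ suc q
      β≡ = level-B (height-A refl) (s≤s z≤n)
      lem : ∀ x y → suc (suc (suc x) + suc (suc y)) < 2 + suc (suc x) * suc (suc y)
      lem x y = ≤-trans (m≤m+n _ (x + y + x * y)) (≤-reflexive (eq x y))
        where
        eq : ∀ x y → 2 + (suc (suc x) + suc (suc y)) + (x + y + x * y) ≡ 2 + suc (suc x) * suc (suc y)
        eq = solve-∀

-- Positions, distances and degrees in a tree

data Pos : Tree → Set where
  here  : Pos •
  left  : ∀ {A B} → Pos A → Pos (A ◁ B)
  right : ∀ {A B} → Pos B → Pos (A ◁ B)

root : ∀ t → Pos t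
root •       = here
root (A ◁ B) = left (root A)

isRoot : ∀ {t} → Pos t → Bool
isRoot here      = true
isRoot (left p)  = isRoot p
isRoot (right p) = false

adjT : ∀ t → Pos t → Pos t → Bool
adjT •       _         _         = false
adjT (A ◁ B) (left p)  (left q)  = adjT A p q
adjT (A ◁ B) (left p)  (right q) = isRoot p ∧ isRoot q
adjT (A ◁ B) (right p) (left q)  = isRoot q ∧ isRoot p
adjT (A ◁ B) (right p) (right q) = adjT B p q

depth : ∀ {t} → Pos t → ℕ
depth here      = 0
depth (left p)  = depth p
depth (right p) = suc (depth p)

distT : ∀ {t} → Pos t → Pos t → ℕ
distT here      here      = 0
distT (left p)  (left q)  = distT p q
distT (left p)  (right q) = suc (depth p + depth q)
distT (right p) (left q)  = suc (depth q + depth p)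
distT (right p) (right q) = distT p q

sumT : ∀ t → (Pos t → ℕ) → ℕ
sumT •       f = f here
sumT (A ◁ B) f = sumT A (f ∘ left) + sumT B (f ∘ right)

⟦_⟧ : Bool → ℕ
⟦ b ⟧ = if b then 1 else 0

adjT-sym : ∀ t p q → adjT t p q ≡ adjT t q p
adjT-sym •       _         _         = refl
adjT-sym (A ◁ B) (left p)  (left q)  = adjT-sym A p q
adjT-sym (A ◁ B) (left p)  (right q) = refl
adjT-sym (A ◁ B) (right p) (left q)  = refl
adjT-sym (A ◁ B) (right p) (right q) = adjT-sym B p q

adjT-irrefl : ∀ t p → adjT t p p ≡ false
adjT-irrefl •       _         = refl
adjT-irrefl (A ◁ B) (left p)  = adjT-irrefl A p
adjT-irrefl (A ◁ B) (right p) = adjT-irrefl B p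

isRoot-root : ∀ t → isRoot (root t) ≡ true
isRoot-root •       = refl
isRoot-root (A ◁ B) = isRoot-root A

isRoot⇒root : ∀ {t} (p : Pos t) → isRoot p ≡ true → p ≡ root t
isRoot⇒root here     _ = refl
isRoot⇒root (left p) e = cong left (isRoot⇒root p e)

depth-root : ∀ t → depth (root t) ≡ 0
depth-root •       = refl
depth-root (A ◁ B) = depth-root A

depth≡0⇒root : ∀ {t} (p : Pos t) → depth p ≡ 0 → p ≡ root t
depth≡0⇒root here     _ = refl
depth≡0⇒root (left p) e = cong left (depth≡0⇒root p e)

distT-rootˡ : ∀ {t} (q : Pos t) → distT (root t) q ≡ depth q
distT-rootˡ here      = refl
distT-rootˡ (left q)  = distT-rootˡ q
distT-rootˡ {A ◁ B} (right q) = cong (λ x → suc (x + depth q)) (depth-root A)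

distT-refl : ∀ {t} (p : Pos t) → distT p p ≡ 0
distT-refl here      = refl
distT-refl (left p)  = distT-refl p
distT-refl (right p) = distT-refl p

distT-sym : ∀ {t} (p q : Pos t) → distT p q ≡ distT q p
distT-sym here      here      = refl
distT-sym (left p)  (left q)  = distT-sym p q
distT-sym (left p)  (right q) = refl
distT-sym (right p) (left q)  = refl
distT-sym (right p) (right q) = distT-sym p q

distT≡0⇒≡ : ∀ {t} (p q : Pos t) → distT p q ≡ 0 → p ≡ q
distT≡0⇒≡ here      here      _ = refl
distT≡0⇒≡ (left p)  (left q)  e = cong left (distT≡0⇒≡ p q e)
distT≡0⇒≡ (right p) (right q) e = cong right (distT≡0⇒≡ p q e)

depth<size : ∀ {t} (p : Pos t) → depth p < size t
depth<size here              = s≤s z≤n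
depth<size (left p)          = ≤-trans (depth<size p) (m≤m+n _ _)
depth<size {A ◁ B} (right p) = ≤-trans (s≤s (depth<size p)) (+-monoˡ-≤ (size B) (≤-trans (s≤s z≤n) (depth<size (root A))))

distT<size : ∀ {t} (p q : Pos t) → distT p q < size t
distT<size here      here      = s≤s z≤n
distT<size (left p)  (left q)  = ≤-trans (distT<size p q) (m≤m+n _ _)
distT<size {A ◁ B} (left p)  (right q) = ≤-trans (≤-reflexive (cong suc (sym (+-suc _ _)))) (+-mono-≤ (depth<size p) (depth<size q))
distT<size {A ◁ B} (right p) (left q)  = ≤-trans (≤-reflexive (cong suc (sym (+-suc _ _)))) (+-mono-≤ (depth<size q) (depth<size p))
distT<size {A ◁ B} (right p) (right q) = ≤-trans (distT<size p q) (m≤n+m _ _)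

∧-true : ∀ {a b} → a ∧ b ≡ true → a ≡ true × b ≡ true
∧-true {true} {true} _ = refl , refl

depth-adj : ∀ t (p r : Pos t) → adjT t p r ≡ true → depth p ≤ suc (depth r)
depth-adj (A ◁ B) (left p)  (left r)  e = depth-adj A p r e
depth-adj (A ◁ B) (left p)  (right r) e
  rewrite isRoot⇒root p (proj₁ (∧-true e)) | depth-root A = z≤n
depth-adj (A ◁ B) (right p) (left r)  e
  rewrite isRoot⇒root p (proj₂ (∧-true e)) | depth-root B = s≤s z≤n
depth-adj (A ◁ B) (right p) (right r) e = s≤s (depth-adj B p r e)

-- This bounds the length of walks from below, and `distT-step` provides a walk of that length;
-- together they identify `distT` with the distance in the graph.
distT-adj : ∀ t (p r q : Pos t) → adjT t p r ≡ true → distT p q ≤ suc (distT r q)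
distT-adj (A ◁ B) (left p)  (left r)  (left q)  e = distT-adj A p r q e
distT-adj (A ◁ B) (left p)  (left r)  (right q) e = s≤s (+-monoˡ-≤ (depth q) (depth-adj A p r e))
distT-adj (A ◁ B) (left p)  (right r) (left q)  e
  rewrite isRoot⇒root p (proj₁ (∧-true e)) | distT-rootˡ q =
    ≤-trans (m≤m+n _ _) (≤-trans (n≤1+n _) (n≤1+n _))
distT-adj (A ◁ B) (left p)  (right r) (right q) e
  rewrite isRoot⇒root p (proj₁ (∧-true e)) | depth-root A
        | isRoot⇒root r (proj₂ (∧-true e)) | distT-rootˡ q = ≤-refl
distT-adj (A ◁ B) (right p) (left r)  (left q)  e
  rewrite isRoot⇒root r (proj₁ (∧-true e)) | distT-rootˡ q
        | isRoot⇒root p (proj₂ (∧-true e)) | depth-root B | +-identityʳ (depth q) = ≤-refl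
distT-adj (A ◁ B) (right p) (left r)  (right q) e
  rewrite isRoot⇒root p (proj₂ (∧-true e)) | distT-rootˡ q =
    ≤-trans (m≤n+m _ _) (≤-trans (n≤1+n _) (n≤1+n _))
distT-adj (A ◁ B) (right p) (right r) (left q)  e =
  s≤s (≤-trans (+-monoʳ-≤ (depth q) (depth-adj B p r e)) (≤-reflexive (+-suc (depth q) (depth r))))
distT-adj (A ◁ B) (right p) (right r) (right q) e = distT-adj B p r q e

roots-adjacent : ∀ A B → isRoot (root A) ∧ isRoot (root B) ≡ true
roots-adjacent A B = cong₂ _∧_ (isRoot-root A) (isRoot-root B)

parent : ∀ t (p : Pos t) {m} → depth p ≡ suc m → ∃[ r ] adjT t p r ≡ true × depth r ≡ m
parent (A ◁ B) (left p) e with parent A p e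
... | r , adj , d = left r , adj , d
parent (A ◁ B) (right p) {zero} e rewrite depth≡0⇒root p (suc-injective e) =
  left (root A) , roots-adjacent A B , depth-root A
parent (A ◁ B) (right p) {suc m} e with parent B p (suc-injective e)
... | r , adj , d = right r , adj , cong suc d

distT-step : ∀ t (p q : Pos t) {m} → distT p q ≡ suc m → ∃[ r ] adjT t p r ≡ true × distT r q ≡ m
distT-step • here here ()
distT-step (A ◁ B) (left p) (left q) e with distT-step A p q e
... | r , adj , d = left r , adj , d
distT-step (A ◁ B) (right p) (right q) e with distT-step B p q e
... | r , adj , d = right r , adj , d
distT-step (A ◁ B) (left p) (right q) {m} e with depth p in eq
... | zero rewrite depth≡0⇒root p eq =
  right (root B) , roots-adjacent A B , trans (distT-rootˡ q) (suc-injective e)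
... | suc _ with parent A p eq
...   | r , adj , refl = left r , adj , suc-injective e
distT-step (A ◁ B) (right p) (left q) {m} e with depth p in eq
... | zero rewrite depth≡0⇒root p eq =
  left (root A) , roots-adjacent A B , trans (distT-rootˡ q) (trans (sym (+-identityʳ _)) (suc-injective e))
... | suc _ with parent B p eq
...   | r , adj , refl = right r , adj , trans (sym (+-suc (depth q) (depth r))) (suc-injective e)

-- Sums over positions: degrees, leaves and close pairs

sumT-cong : ∀ t {f g} → (∀ p → f p ≡ g p) → sumT t f ≡ sumT t g
sumT-cong •       e = e here
sumT-cong (A ◁ B) e = cong₂ _+_ (sumT-cong A (e ∘ left)) (sumT-cong B (e ∘ right))

+-interchange : ∀ a b c d → a + b + (c + d) ≡ a + c + (b + d)
+-interchange = solve-∀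

sumT-+ : ∀ t f g → sumT t (λ p → f p + g p) ≡ sumT t f + sumT t g
sumT-+ •       f g = refl
sumT-+ (A ◁ B) f g = trans (cong₂ _+_ (sumT-+ A (f ∘ left) (g ∘ left)) (sumT-+ B (f ∘ right) (g ∘ right)))
  (+-interchange (sumT A (f ∘ left)) _ _ _)

sumT-0 : ∀ t → sumT t (λ _ → 0) ≡ 0
sumT-0 •       = refl
sumT-0 (A ◁ B) = cong₂ _+_ (sumT-0 A) (sumT-0 B)

sumT-swap : ∀ s t (f : Pos s → Pos t → ℕ) → sumT s (λ p → sumT t (f p)) ≡ sumT t (λ q → sumT s (λ p → f p q))
sumT-swap •       t f = refl
sumT-swap (A ◁ B) t f = trans (cong₂ _+_ (sumT-swap A t (f ∘ left)) (sumT-swap B t (f ∘ right)))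
  (sym (sumT-+ t _ _))

sumT-root : ∀ t → sumT t (λ p → ⟦ isRoot p ⟧) ≡ 1
sumT-root •       = refl
sumT-root (A ◁ B) = cong₂ _+_ (sumT-root A) (sumT-0 B)

degT : ∀ t → Pos t → ℕ
degT t p = sumT t (λ q → ⟦ adjT t p q ⟧)

degT-left : ∀ A B (p : Pos A) → degT (A ◁ B) (left p) ≡ degT A p + ⟦ isRoot p ⟧
degT-left A B p = cong (degT A p +_) (lem (isRoot p))
  where
  lem : ∀ b → sumT B (λ q → ⟦ b ∧ isRoot q ⟧) ≡ ⟦ b ⟧
  lem false = sumT-0 B
  lem true  = sumT-root B

degT-right : ∀ A B (p : Pos B) → degT (A ◁ B) (right p) ≡ degT B p + ⟦ isRoot p ⟧
degT-right A B p = trans (cong (_+ degT B p) (lem (isRoot p))) (+-comm ⟦ isRoot p ⟧ (degT B p))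
  where
  lem : ∀ b → sumT A (λ q → ⟦ isRoot q ∧ b ⟧) ≡ ⟦ b ⟧
  lem false = trans (sumT-cong A (λ q → cong ⟦_⟧ (∧-comm (isRoot q) false))) (sumT-0 A)
  lem true  = trans (sumT-cong A (λ q → cong ⟦_⟧ (∧-comm (isRoot q) true))) (sumT-root A)

sumT-degT : ∀ t → sumT t (degT t) + 2 ≡ size t + size t
sumT-degT •       = refl
sumT-degT (A ◁ B) = begin
  sumT A (degT (A ◁ B) ∘ left) + sumT B (degT (A ◁ B) ∘ right) + 2
    ≡⟨ cong (_+ 2) (cong₂ _+_
         (trans (sumT-cong A (degT-left A B)) (trans (sumT-+ A _ _) (cong (sumT A (degT A) +_) (sumT-root A))))
         (trans (sumT-cong B (degT-right A B)) (trans (sumT-+ B _ _) (cong (sumT B (degT B) +_) (sumT-root B))))) ⟩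
  sumT A (degT A) + 1 + (sumT B (degT B) + 1) + 2
    ≡⟨ lem (sumT A (degT A)) (sumT B (degT B)) ⟩
  sumT A (degT A) + 2 + (sumT B (degT B) + 2)
    ≡⟨ cong₂ _+_ (sumT-degT A) (sumT-degT B) ⟩
  size A + size A + (size B + size B)
    ≡⟨ +-interchange (size A) (size A) (size B) (size B) ⟩
  size A + size B + (size A + size B) ∎
  where
  open ≡-Reasoning
  lem : ∀ a b → a + 1 + (b + 1) + 2 ≡ a + 2 + (b + 2)
  lem = solve-∀

-- The summand c * ⟦ isRoot p ⟧ stands for c further edges at the root.
sumT-leaves : ∀ A → sumT A (λ p → ⟦ degT A p + 1 * ⟦ isRoot p ⟧ ≡ᵇ 1 ⟧) ≡ leaves A
sumT-nonRootLeaves : ∀ A c → sumT A (λ p → ⟦ degT A p + (2 + c) * ⟦ isRoot p ⟧ ≡ᵇ 1 ⟧) ≡ nonRootLeaves A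
sumT-pendent-◁ : ∀ A B c → sumT (A ◁ B) (λ p → ⟦ degT (A ◁ B) p + c * ⟦ isRoot p ⟧ ≡ᵇ 1 ⟧)
  ≡ sumT A (λ p → ⟦ degT A p + suc c * ⟦ isRoot p ⟧ ≡ᵇ 1 ⟧) + leaves B
sumT-pendent-◁ A B c = cong₂ _+_
  (sumT-cong A (λ p → cong (λ x → ⟦ x ≡ᵇ 1 ⟧) (trans (cong (_+ c * ⟦ isRoot p ⟧) (degT-left A B p))
    (+-assoc (degT A p) _ _))))
  (trans (sumT-cong B (λ p → cong (λ x → ⟦ x ≡ᵇ 1 ⟧) (trans (cong₂ _+_ (degT-right A B p) (*-zeroʳ c))
      (trans (+-identityʳ _) (cong (degT B p +_) (sym (*-identityˡ _)))))))
    (sumT-leaves B))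
sumT-leaves •       = refl
sumT-leaves (A ◁ B) = trans (sumT-pendent-◁ A B 1) (cong (_+ leaves B) (sumT-nonRootLeaves A 0))
sumT-nonRootLeaves •       c = refl
sumT-nonRootLeaves (A ◁ B) c = trans (sumT-pendent-◁ A B (2 + c)) (cong (_+ leaves B) (sumT-nonRootLeaves A (suc c)))

sumT-pendents : ∀ t → sumT t (λ p → ⟦ degT t p ≡ᵇ 1 ⟧) ≡ pendents t
sumT-pendents •       = refl
sumT-pendents (A ◁ B) = trans
  (sumT-cong (A ◁ B) (λ p → cong (λ x → ⟦ x ≡ᵇ 1 ⟧) (sym (+-identityʳ (degT (A ◁ B) p)))))
  (trans (sumT-pendent-◁ A B 0) (cong (_+ leaves B) (sumT-leaves A)))

<ᵇ-∸ : ∀ c x D → (c + x <ᵇ D) ≡ (x <ᵇ D ∸ c)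
<ᵇ-∸ zero    x D       = refl
<ᵇ-∸ (suc c) x zero    = refl
<ᵇ-∸ (suc c) x (suc D) = <ᵇ-∸ c x D

sumT-ball : ∀ t m → sumT t (λ p → ⟦ depth p <ᵇ m ⟧) ≡ S (level t) m
sumT-ball t       zero    = sumT-0 t
sumT-ball •       (suc m) = sym (S-level≡size • {suc m} (s≤s z≤n))
sumT-ball (A ◁ B) (suc m) = trans (cong₂ _+_ (sumT-ball A (suc m)) (sumT-ball B m)) (sym (S-level-◁ A B m))

-- The vertices are grouped by depth. Those of depth D or more contribute an empty sum, because `∸`
-- truncates.
sumT-conv : ∀ t g D → sumT t (λ p → S g (D ∸ depth p)) ≡ conv (level t) g D
sumT-conv t g zero = trans (sumT-cong t (λ p → cong (S g) (0∸n≡0 (depth p)))) (sumT-0 t)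
sumT-conv •       g (suc D) = sym (trans (conv-level • g D) (trans (cong (S g (suc D) +_) (conv-zeroˡ g D)) (+-identityʳ _)))
sumT-conv (A ◁ B) g (suc D) = trans (cong₂ _+_ (sumT-conv A g (suc D)) (sumT-conv B g D))
  (trans (+-assoc (level A 0 * S g (suc D)) _ _)
    (cong (level A 0 * S g (suc D) +_) (sym (conv-+ˡ (level⁺ A) (level B) g D))))

sumT-cross : ∀ A B D → sumT A (λ p → sumT B (λ q → ⟦ suc (depth p + depth q) ≤ᵇ D ⟧)) ≡ conv (level A) (level B) D
sumT-cross A B D = trans
  (sumT-cong A (λ p → trans (sumT-cong B (λ q → cong ⟦_⟧ (<ᵇ-∸ (depth p) (depth q) D))) (sumT-ball B (D ∸ depth p))))
  (sumT-conv A (level B) D)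

-- Ordered pairs need no order on positions and are therefore preserved by relabelling; `near` is
-- recovered from them by cancelling and halving.
sumT-near : ∀ t D → sumT t (λ p → sumT t (λ q → ⟦ distT p q ≤ᵇ D ⟧)) ≡ size t + (near t D + near t D)
sumT-near •       D = refl
sumT-near (A ◁ B) D = begin
  sumT A (λ p → sumT A (λ q → ⟦ distT p q ≤ᵇ D ⟧) + sumT B (λ q → ⟦ suc (depth p + depth q) ≤ᵇ D ⟧))
  + sumT B (λ p → sumT A (λ q → ⟦ suc (depth q + depth p) ≤ᵇ D ⟧) + sumT B (λ q → ⟦ distT p q ≤ᵇ D ⟧))
    ≡⟨ cong₂ _+_ (sumT-+ A _ _) (sumT-+ B _ _) ⟩
  sumT A (λ p → sumT A (λ q → ⟦ distT p q ≤ᵇ D ⟧)) + sumT A (λ p → sumT B (λ q → ⟦ suc (depth p + depth q) ≤ᵇ D ⟧))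
  + (sumT B (λ p → sumT A (λ q → ⟦ suc (depth q + depth p) ≤ᵇ D ⟧)) + sumT B (λ p → sumT B (λ q → ⟦ distT p q ≤ᵇ D ⟧)))
    ≡⟨ cong₂ _+_ (cong₂ _+_ (sumT-near A D) (sumT-cross A B D))
         (cong₂ _+_ (trans (sumT-swap B A _) (sumT-cross A B D)) (sumT-near B D)) ⟩
  size A + (near A D + near A D) + C + (C + (size B + (near B D + near B D)))
    ≡⟨ lem (size A) (size B) (near A D) (near B D) C ⟩
  size A + size B + (near A D + near B D + C + (near A D + near B D + C)) ∎
  where
  open ≡-Reasoning
  C = conv (level A) (level B) D
  lem : ∀ a b x y c → a + (x + x) + c + (c + (b + (y + y))) ≡ a + b + (x + y + c + (x + y + c))
  lem = solve-∀

-- Isomorphisms and central edges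

-- Stated for bare adjacency functions, so that graphs on `Fin n` and trees on `Pos t` can be
-- compared in any combination.
record Iso {V W : Set} (a : V → V → Bool) (b : W → W → Bool) : Set where
  constructor iso
  field
    bij      : V ↔ W
    adjacent : ∀ x y → b (to bij x) (to bij y) ≡ a x y
open Iso

Iso-sym : ∀ {V W} {a : V → V → Bool} {b : W → W → Bool} → Iso a b → Iso b a
Iso-sym {b = b} (iso f e) = iso (↔-sym f) λ x y →
  trans (sym (e (from f x) (from f y))) (cong₂ b (strictlyInverseˡ f x) (strictlyInverseˡ f y))

Iso-trans : ∀ {U V W} {a : U → U → Bool} {b : V → V → Bool} {c : W → W → Bool} → Iso a b → Iso b c → Iso a c
Iso-trans (iso f e) (iso g e′) = iso (g ↔-∘ f) λ x y → trans (e′ (to f x) (to f y)) (e x y)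

_≈ᵀ_ : Tree → Tree → Set
s ≈ᵀ t = Iso (adjT s) (adjT t)

≈ᵀ-refl : ∀ {t} → t ≈ᵀ t
≈ᵀ-refl = iso (↔-id _) λ _ _ → refl

-- Adjacency across `◁` depends on the two roots; an isomorphism has to respect them to be a
-- congruence for `◁`.
record _≈ᴿ_ (s t : Tree) : Set where
  field
    unrooted  : s ≈ᵀ t
    keepsRoot : ∀ p → isRoot (to (bij unrooted) p) ≡ isRoot p
open _≈ᴿ_

≈ᴿ-refl : ∀ {t} → t ≈ᴿ t
≈ᴿ-refl = record { unrooted = ≈ᵀ-refl ; keepsRoot = λ _ → refl }

≈ᴿ-trans : ∀ {s t u} → s ≈ᴿ t → t ≈ᴿ u → s ≈ᴿ u
≈ᴿ-trans e e′ = record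
  { unrooted = Iso-trans (unrooted e) (unrooted e′)
  ; keepsRoot = λ p → trans (keepsRoot e′ _) (keepsRoot e p) }

mapPos : ∀ {A A′ B B′} → (Pos A → Pos A′) → (Pos B → Pos B′) → Pos (A ◁ B) → Pos (A′ ◁ B′)
mapPos f g (left p)  = left (f p)
mapPos f g (right p) = right (g p)

◁-cong : ∀ {A A′ B B′} → A ≈ᴿ A′ → B ≈ᴿ B′ → (A ◁ B) ≈ᴿ (A′ ◁ B′)
◁-cong {A} {A′} {B} {B′} e e′ = record { unrooted = iso f∪g adjacency ; keepsRoot = roots }
  where
  f = bij (unrooted e)
  g = bij (unrooted e′)
  f∪g : Pos (A ◁ B) ↔ Pos (A′ ◁ B′)
  f∪g = mk↔ₛ′ (mapPos (to f) (to g)) (mapPos (from f) (from g))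
    (λ { (left p)  → cong left (strictlyInverseˡ f p) ; (right p) → cong right (strictlyInverseˡ g p) })
    (λ { (left p)  → cong left (strictlyInverseʳ f p) ; (right p) → cong right (strictlyInverseʳ g p) })
  adjacency : ∀ p q → adjT (A′ ◁ B′) (mapPos (to f) (to g) p) (mapPos (to f) (to g) q) ≡ adjT (A ◁ B) p q
  adjacency (left p)  (left q)  = adjacent (unrooted e) p q
  adjacency (left p)  (right q) = cong₂ _∧_ (keepsRoot e p) (keepsRoot e′ q)
  adjacency (right p) (left q)  = cong₂ _∧_ (keepsRoot e q) (keepsRoot e′ p)
  adjacency (right p) (right q) = adjacent (unrooted e′) p q
  roots : ∀ p → isRoot (mapPos (to f) (to g) p) ≡ isRoot p
  roots (left p)  = keepsRoot e p
  roots (right p) = refl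

◁-exchange : ∀ A B C → (A ◁ B ◁ C) ≈ᴿ (A ◁ C ◁ B)
◁-exchange A B C = record { unrooted = iso (mk↔ₛ′ (f A B C) (f A C B) (inv A C B) (inv A B C)) adjacency ; keepsRoot = roots }
  where
  f : ∀ A B C → Pos (A ◁ B ◁ C) → Pos (A ◁ C ◁ B)
  f A B C (left (left p))  = left (left p)
  f A B C (left (right p)) = right p
  f A B C (right p)        = left (right p)
  inv : ∀ A B C p → f A C B (f A B C p) ≡ p
  inv A B C (left (left p))  = refl
  inv A B C (left (right p)) = refl
  inv A B C (right p)        = refl
  adjacency : ∀ p q → adjT (A ◁ C ◁ B) (f A B C p) (f A B C q) ≡ adjT (A ◁ B ◁ C) p q
  adjacency (left (left p))  (left (left q))  = refl
  adjacency (left (left p))  (left (right q)) = refl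
  adjacency (left (left p))  (right q)        = refl
  adjacency (left (right p)) (left (left q))  = refl
  adjacency (left (right p)) (left (right q)) = refl
  adjacency (left (right p)) (right q)        = refl
  adjacency (right p)        (left (left q))  = refl
  adjacency (right p)        (left (right q)) = refl
  adjacency (right p)        (right q)        = refl
  roots : ∀ p → isRoot (f A B C p) ≡ isRoot p
  roots (left (left p))  = refl
  roots (left (right p)) = refl
  roots (right p)        = refl

-- The root moves to the other end of the top edge, hence only `≈ᵀ`. With `◁-exchange` this lets the
-- distinguished edge travel through the tree.
◁-swap : ∀ A B → (A ◁ B) ≈ᵀ (B ◁ A)
◁-swap A B = iso (mk↔ₛ′ (f A B) (f B A) (inv B A) (inv A B)) adjacency
  where
  f : ∀ A B → Pos (A ◁ B) → Pos (B ◁ A)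
  f A B (left p)  = right p
  f A B (right p) = left p
  inv : ∀ A B p → f B A (f A B p) ≡ p
  inv A B (left p)  = refl
  inv A B (right p) = refl
  adjacency : ∀ p q → adjT (B ◁ A) (f A B p) (f A B q) ≡ adjT (A ◁ B) p q
  adjacency (left p)  (left q)  = refl
  adjacency (left p)  (right q) = ∧-comm (isRoot q) (isRoot p)
  adjacency (right p) (left q)  = ∧-comm (isRoot p) (isRoot q)
  adjacency (right p) (right q) = refl

-- A child of maximal height is brought to the outermost position by exchanging siblings, so that
-- its edge becomes the top edge of B.
deepestChild : ∀ B → 1 ≤ height B →
  ∃[ B′ ] ∃[ C ] (B ≈ᴿ (B′ ◁ C)) × height B′ ≤ height B × suc (height C) ≡ height B
deepestChild (X ◁ Y) _ with height X ≤? suc (height Y)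
... | yes X≤Y = X , Y , ≈ᴿ-refl , m≤m⊔n _ _ , sym (m≤n⇒m⊔n≡n X≤Y)
... | no  X≰Y with deepestChild X (≤-trans (s≤s z≤n) (≰⇒> X≰Y))
...   | X′ , C , e , X′≤X , C≡X =
  X′ ◁ Y , C , ≈ᴿ-trans (◁-cong e ≈ᴿ-refl) (◁-exchange X′ C Y)
  , ⊔-monoˡ-≤ (suc (height Y)) X′≤X
  , trans C≡X (sym (m≥n⇒m⊔n≡m (<⇒≤ (≰⇒> X≰Y))))

record CentralEdge (t : Tree) : Set where
  field
    A B  : Tree
    t≈AB : t ≈ᵀ (A ◁ B)
    B≤A  : height B ≤ height A
    A≤B  : height A ≤ suc (height B)

centralEdge-≈ : ∀ {s t} → s ≈ᵀ t → CentralEdge t → CentralEdge s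
centralEdge-≈ e c = record { CentralEdge c ; t≈AB = Iso-trans e (CentralEdge.t≈AB c) }

-- Moving the edge towards the deepest vertices of the higher side lowers that
-- side by one, and never makes the other side overtake it by more than one.
centralEdge : ∀ m A B → height B ≡ m → height A ≤ suc m → CentralEdge (A ◁ B)
centralEdge m A B hB A≤ with height B ≤? height A | height B ≤? suc (height A)
... | yes B≤A | _ = record { A = A ; B = B ; t≈AB = ≈ᵀ-refl ; B≤A = B≤A ; A≤B = subst (λ x → height A ≤ suc x) (sym hB) A≤ }
... | no  B≰A | yes B≤A = record { A = B ; B = A ; t≈AB = ◁-swap A B ; B≤A = <⇒≤ (≰⇒> B≰A) ; A≤B = B≤A }
centralEdge zero A B hB A≤ | no  B≰A | no _ = contradiction (subst (_≤ height A) (sym hB) z≤n) B≰A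
centralEdge (suc m) A B hB A≤ | no _ | no  B≰A with deepestChild B (subst (1 ≤_) (sym hB) (s≤s z≤n))
... | B′ , C , e , B′≤B , C≡B = centralEdge-≈
  (Iso-trans (unrooted (◁-cong ≈ᴿ-refl e)) (Iso-trans (◁-swap A (B′ ◁ C)) (unrooted (◁-exchange B′ C A))))
  (centralEdge m (B′ ◁ A) C (suc-injective (trans C≡B hB))
    (subst (height (B′ ◁ A) ≤_) hB (⊔-lub B′≤B (≤-trans (n≤1+n _) (≰⇒> B≰A)))))

hasCentralEdge : ∀ t → 2 ≤ size t → CentralEdge t
hasCentralEdge •       (s≤s ())
hasCentralEdge (A ◁ B) _ with height A ≤? suc (height B)
... | yes A≤B = centralEdge (height B) A B refl A≤B
... | no  A≰B = centralEdge-≈ (◁-swap A B)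
  (centralEdge (height A) B A refl (≤-trans (n≤1+n _) (≤-trans (n≤1+n _) (≤-trans (≰⇒> A≰B) (n≤1+n _)))))

spider-↭ : ∀ {L L′} → L ↭ L′ → spider L ≈ᴿ spider L′
spider-↭ ↭.refl                       = ≈ᴿ-refl
spider-↭ (↭.prep x e)                 = ◁-cong (spider-↭ e) ≈ᴿ-refl
spider-↭ (↭.swap {xs} x y e)          = ≈ᴿ-trans (◁-exchange (spider xs) (chain y) (chain x))
  (◁-cong (◁-cong (spider-↭ e) ≈ᴿ-refl) ≈ᴿ-refl)
spider-↭ (↭.trans e e′)               = ≈ᴿ-trans (spider-↭ e) (spider-↭ e′)

-- Enumerating the positions of a tree

sum-split : ∀ m n (f : Fin (m + n) → ℕ) → sum f ≡ sum (f ∘ (_↑ˡ n)) + sum (f ∘ (m ↑ʳ_))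
sum-split zero    n f = refl
sum-split (suc m) n f = trans (cong (f zero +_) (sum-split m n (f ∘ suc))) (sym (+-assoc (f zero) _ _))

⊎↔Pos : ∀ A B → (Pos A ⊎ Pos B) ↔ Pos (A ◁ B)
⊎↔Pos A B = mk↔ₛ′ (λ { (inj₁ p) → left p ; (inj₂ p) → right p }) (λ { (left p) → inj₁ p ; (right p) → inj₂ p })
  (λ { (left p) → refl ; (right p) → refl }) (λ { (inj₁ p) → refl ; (inj₂ p) → refl })

enumerate : ∀ t → Fin (size t) ↔ Pos t
enumerate •       = mk↔ₛ′ (λ _ → here) (λ _ → zero) (λ { here → refl }) (λ { zero → refl })
enumerate (A ◁ B) = ⊎↔Pos A B ↔-∘ ((enumerate A ⊎-↔ enumerate B) ↔-∘ +↔⊎)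

sum-enumerate : ∀ t (f : Pos t → ℕ) → sum (f ∘ to (enumerate t)) ≡ sumT t f
sum-enumerate •       f = +-identityʳ _
sum-enumerate (A ◁ B) f = trans (sum-split (size A) (size B) _) (cong₂ _+_
  (trans (sum-cong-≗ (λ i → cong f (eˡ i))) (sum-enumerate A (f ∘ left)))
  (trans (sum-cong-≗ (λ i → cong f (eʳ i))) (sum-enumerate B (f ∘ right))))
  where
  eˡ : ∀ i → to (enumerate (A ◁ B)) (i ↑ˡ size B) ≡ left (to (enumerate A) i)
  eˡ i rewrite splitAt-↑ˡ (size A) i (size B) = refl
  eʳ : ∀ i → to (enumerate (A ◁ B)) (size A ↑ʳ i) ≡ right (to (enumerate B) i)
  eʳ i rewrite splitAt-↑ʳ (size A) (size B) i = refl

-- Two numberings of the positions differ by a permutation of the indices, which leaves the sum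
-- unchanged.
sum-↔ : ∀ {n} t (f : Fin n ↔ Pos t) (g : Pos t → ℕ) → sum (g ∘ to f) ≡ sumT t g
sum-↔ t f g = trans (sym (trans (sum-permute (g ∘ to (enumerate t)) (↔-sym (enumerate t) ↔-∘ f))
    (sum-cong-≗ (λ i → cong g (strictlyInverseˡ (enumerate t) (to f i))))))
  (sum-enumerate t g)

↔-size : ∀ {n} t → Fin n ↔ Pos t → n ≡ size t
↔-size t f = ↔⇒≡ (↔-sym (enumerate t) ↔-∘ f)

-- Graphs isomorphic to trees

listSum-allFin : ∀ {n} (f : Fin n → ℕ) → ListAction.sum (map f (allFin n)) ≡ sum f
listSum-allFin f = trans (cong ListAction.sum (map-tabulate (λ i → i) f)) (lem f)
  where
  lem : ∀ {n} (f : Fin n → ℕ) → ListAction.sum (tabulate f) ≡ sum f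
  lem {zero}  f = refl
  lem {suc n} f = cong (f zero +_) (lem (f ∘ suc))

length-filter : ∀ {A : Set} {P : A → Set} (P? : ∀ x → Dec (P x)) xs →
  length (filter P? xs) ≡ ListAction.sum (map (λ x → ⟦ does (P? x) ⟧) xs)
length-filter P? []       = refl
length-filter P? (x ∷ xs) with does (P? x)
... | true  = cong suc (length-filter P? xs)
... | false = length-filter P? xs

does-≟true : ∀ b → does (b Data.Bool.≟ true) ≡ b
does-≟true true  = refl
does-≟true false = refl

degree-sum : ∀ {n} (G : Graph n) x → degree G x ≡ sum (λ z → ⟦ adj G x z ⟧)
degree-sum {n} G x = trans (length-filter (λ z → adj G x z Data.Bool.≟ true) (allFin n))
  (trans (listSum-allFin (λ z → ⟦ does (adj G x z Data.Bool.≟ true) ⟧)) (sum-cong-≗ (λ z → cong ⟦_⟧ (does-≟true (adj G x z)))))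

pendentCount-sum : ∀ {n} (G : Graph n) → pendentCount G ≡ sum (λ x → ⟦ degree G x ≡ᵇ 1 ⟧)
pendentCount-sum {n} G = trans (length-filter (λ x → degree G x Data.Nat.≟ 1) (allFin n))
  (listSum-allFin (λ x → ⟦ degree G x ≡ᵇ 1 ⟧))

upper : ∀ {n} → (Fin n → Fin n → ℕ) → ℕ
upper h = sum (λ x → sum (λ y → if toℕ x <ᵇ toℕ y then h x y else 0))

-- The induction splits off the first row and the first column, which agree by symmetry. It links
-- sums over x < y to sums over all ordered pairs.
sum-symmetric : ∀ {n} (h : Fin n → Fin n → ℕ) → (∀ x y → h x y ≡ h y x) →
  sum (λ x → sum (h x)) ≡ sum (λ x → h x x) + (upper h + upper h)
sum-symmetric {zero}  h s = refl
sum-symmetric {suc n} h s = begin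
  h zero zero + a + sum (λ x → h (suc x) zero + sum (λ y → h (suc x) (suc y)))
    ≡⟨ cong (h zero zero + a +_) (∑-distrib-+ (λ x → h (suc x) zero) _) ⟩
  h zero zero + a + (sum (λ x → h (suc x) zero) + sum (λ x → sum (λ y → h (suc x) (suc y))))
    ≡⟨ cong₂ (λ u v → h zero zero + a + (u + v)) (sum-cong-≗ (λ x → s (suc x) zero))
         (sum-symmetric (λ x y → h (suc x) (suc y)) (λ x y → s (suc x) (suc y))) ⟩
  h zero zero + a + (a + (sum (λ x → h (suc x) (suc x)) + (u + u)))
    ≡⟨ lem (h zero zero) a _ u ⟩
  h zero zero + sum (λ x → h (suc x) (suc x)) + ((a + u) + (a + u)) ∎
  where
  open ≡-Reasoning
  a = sum (λ y → h zero (suc y))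
  u = upper (λ x y → h (suc x) (suc y))
  lem : ∀ h a d u → h + a + (a + (d + (u + u))) ≡ h + d + ((a + u) + (a + u))
  lem = solve-∀

sum-mono : ∀ {n} {f g : Fin n → ℕ} → (∀ i → f i ≤ g i) → sum f ≤ sum g
sum-mono {zero}  e = z≤n
sum-mono {suc n} e = +-mono-≤ (e zero) (sum-mono (e ∘ suc))

sum-squeeze : ∀ {n} {f g : Fin n → ℕ} → (∀ i → f i ≤ g i) → sum g ≤ sum f → ∀ i → f i ≡ g i
sum-squeeze {suc n} {f} {g} f≤g le zero    = ≤-antisym (f≤g zero)
  (+-cancelʳ-≤ (sum (f ∘ suc)) _ _ (≤-trans (+-monoʳ-≤ (g zero) (sum-mono (f≤g ∘ suc))) le))
sum-squeeze {suc n} {f} {g} f≤g le (suc i) = sum-squeeze (f≤g ∘ suc)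
  (+-cancelˡ-≤ (f zero) _ _ (≤-trans (+-monoˡ-≤ (sum (g ∘ suc)) (f≤g zero)) le)) i

sum-const : ∀ n c → sum {n} (λ _ → c) ≡ n * c
sum-const zero    c = refl
sum-const (suc n) c = cong (c +_) (sum-const n c)

edgeCount-upper : ∀ {n} (G : Graph n) → edgeCount G ≡ upper (λ x y → ⟦ adj G x y ⟧)
edgeCount-upper {n} G = trans (listSum-allFin (λ x → ListAction.sum (map (edge x) (allFin n))))
  (sum-cong-≗ (λ x → trans (listSum-allFin (edge x)) (sum-cong-≗ (λ y → lem (toℕ x <ᵇ toℕ y) (adj G x y)))))
  where
  edge : Fin n → Fin n → ℕ
  edge x y = if (toℕ x <ᵇ toℕ y) ∧ adj G x y then 1 else 0
  lem : ∀ a b → (if a ∧ b then 1 else 0) ≡ (if a then ⟦ b ⟧ else 0)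
  lem true  b = refl
  lem false b = refl

handshake : ∀ {n} (G : Graph n) → sum (λ x → sum (λ y → ⟦ adj G x y ⟧)) ≡ edgeCount G + edgeCount G
handshake {n} G = trans (sum-symmetric _ (λ x y → cong ⟦_⟧ (adj-sym G x y)))
  (cong₂ _+_ (trans (sum-cong-≗ (λ x → cong ⟦_⟧ (adj-irrefl G x))) (trans (sum-const n 0) (*-zeroʳ n)))
    (sym (cong₂ _+_ (edgeCount-upper G) (edgeCount-upper G))))

anyV⁻ : ∀ {n} (p : Fin n → Bool) → anyV p ≡ true → ∃[ z ] p z ≡ true
anyV⁻ {n} p = go (λ i → i)
  where
  go : ∀ {m} (g : Fin m → Fin n) → foldr (λ x b → p x ∨ b) false (tabulate g) ≡ true → ∃[ z ] p z ≡ true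
  go {suc m} g e with p (g zero) in eq
  ... | true  = g zero , eq
  ... | false = go (g ∘ suc) e

anyV⁺ : ∀ {n} (p : Fin n → Bool) {z} → p z ≡ true → anyV p ≡ true
anyV⁺ {n} p {z} = go (λ i → i) z
  where
  go : ∀ {m} (g : Fin m → Fin n) i → p (g i) ≡ true → foldr (λ x b → p x ∨ b) false (tabulate g) ≡ true
  go g zero    e rewrite e = refl
  go g (suc i) e rewrite go (g ∘ suc) i e = ∨-zeroʳ (p (g zero))

≡true-ext : ∀ {a b} → (a ≡ true → b ≡ true) → (b ≡ true → a ≡ true) → a ≡ b
≡true-ext {true}          f g = sym (f refl)
≡true-ext {false} {true}  f g = g refl
≡true-ext {false} {false} f g = refl

≤ᵇ≡true⇒≤ : ∀ {m n} → (m ≤ᵇ n) ≡ true → m ≤ n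
≤ᵇ≡true⇒≤ {m} e = ≤ᵇ⇒≤ m _ (Equivalence.from T-≡ e)

≤⇒≤ᵇ≡true : ∀ {m n} → m ≤ n → (m ≤ᵇ n) ≡ true
≤⇒≤ᵇ≡true le = Equivalence.to T-≡ (≤⇒≤ᵇ le)

∨-true : ∀ {a b} → a ∨ b ≡ true → a ≡ true ⊎ b ≡ true
∨-true {true}  _ = inj₁ refl
∨-true {false} e = inj₂ e

==⇒≡ : ∀ {n} {x y : Fin n} → (x == y) ≡ true → x ≡ y
==⇒≡ {x = x} {y} e = toℕ-injective (≡ᵇ⇒≡ (toℕ x) (toℕ y) (Equivalence.from T-≡ e))

≡⇒== : ∀ {n} {x y : Fin n} → x ≡ y → (x == y) ≡ true
≡⇒== {x = x} refl = Equivalence.to T-≡ (≡⇒≡ᵇ (toℕ x) (toℕ x) refl)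

-- Degrees, distances and pair counts of a graph represented by a tree

module _ {n} (G : Graph n) (t : Tree) (rep : Iso (adj G) (adjT t)) where
  private
    φ : Fin n → Pos t
    φ = to (bij rep)

    δ : Fin n → Fin n → ℕ
    δ x y = distT (φ x) (φ y)

  Iso⇒n≡size : n ≡ size t
  Iso⇒n≡size = ↔-size t (bij rep)

  Iso⇒degree : ∀ x → degree G x ≡ degT t (φ x)
  Iso⇒degree x = trans (degree-sum G x) (trans (sum-cong-≗ (λ z → cong ⟦_⟧ (sym (adjacent rep x z))))
    (sum-↔ t (bij rep) (λ q → ⟦ adjT t (φ x) q ⟧)))

  Iso⇒pendentCount : pendentCount G ≡ pendents t
  Iso⇒pendentCount = trans (pendentCount-sum G) (trans (sum-cong-≗ (λ x → cong (λ d → ⟦ d ≡ᵇ 1 ⟧) (Iso⇒degree x)))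
    (trans (sum-↔ t (bij rep) (λ p → ⟦ degT t p ≡ᵇ 1 ⟧)) (sumT-pendents t)))

  private
    within⇒ : ∀ D x y → within G D x y ≡ true → δ x y ≤ D
    within⇒ zero    x y e rewrite ==⇒≡ {x = x} {y} e = ≤-reflexive (distT-refl (φ y))
    within⇒ (suc D) x y e with ∨-true {within G D x y} e
    ... | inj₁ w = ≤-trans (within⇒ D x y w) (n≤1+n D)
    ... | inj₂ a with anyV⁻ (λ z → adj G x z ∧ within G D z y) a
    ...   | z , az with ∧-true {adj G x z} az
    ...     | xz , zy = ≤-trans (distT-adj t (φ x) (φ z) (φ y) (trans (adjacent rep x z) xz)) (s≤s (within⇒ D z y zy))

    within⇐ : ∀ D x y → δ x y ≤ D → within G D x y ≡ true
    within⇐ zero    x y le = ≡⇒== (trans (sym (strictlyInverseʳ (bij rep) x))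
      (trans (cong (from (bij rep)) (distT≡0⇒≡ (φ x) (φ y) (n≤0⇒n≡0 le))) (strictlyInverseʳ (bij rep) y)))
    within⇐ (suc D) x y le with m≤n⇒m<n∨m≡n le
    ... | inj₁ lt rewrite within⇐ D x y (s≤s⁻¹ lt) = refl
    ... | inj₂ eq with distT-step t (φ x) (φ y) eq
    ...   | r , xr , ry rewrite anyV⁺ (λ z → adj G x z ∧ within G D z y) {from (bij rep) r} (cong₂ _∧_
              (trans (sym (adjacent rep x _)) (trans (cong (adjT t (φ x)) (strictlyInverseˡ (bij rep) r)) xr))
              (within⇐ D _ y (≤-reflexive (trans (cong (λ p → distT p (φ y)) (strictlyInverseˡ (bij rep) r)) ry))))
            = ∨-zeroʳ (within G D x y)

  Iso⇒within : ∀ D x y → within G D x y ≡ (δ x y ≤ᵇ D)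
  Iso⇒within D x y = ≡true-ext (λ e → ≤⇒≤ᵇ≡true (within⇒ D x y e)) (λ e → within⇐ D x y (≤ᵇ≡true⇒≤ e))

  dist<n : ∀ x y → δ x y < n
  dist<n x y = subst (δ x y <_) (sym Iso⇒n≡size) (distT<size (φ x) (φ y))

  Iso⇒connected : Connected G
  Iso⇒connected x y = within⇐ n x y (<⇒≤ (dist<n x y))

  Iso⇒dist : ∀ x y → dist G x y ≡ δ x y
  Iso⇒dist x y = go 0 n z≤n (<⇒≤ (dist<n x y))
    where
    -- The search stands at k with fuel f and k ≤ δ ≤ k + f; when the fuel runs out, the default
    -- value k is therefore the distance.
    go : ∀ k f → k ≤ δ x y → δ x y ≤ k + f → distFrom G x y k f ≡ δ x y
    go k zero    lo hi = ≤-antisym lo (subst (δ x y ≤_) (+-identityʳ k) hi)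
    go k (suc f) lo hi with within G k x y in eq
    ... | true  = ≤-antisym lo (within⇒ k x y eq)
    ... | false = go (suc k) f
      (≰⇒> (λ le → contradiction (trans (sym (within⇐ k x y le)) eq) λ ()))
      (subst (δ x y ≤_) (+-suc k f) hi)

  Iso⇒sum-within : ∀ D → sum (λ x → sum (λ y → ⟦ within G D x y ⟧)) ≡ n + (near t D + near t D)
  Iso⇒sum-within D = begin
    sum (λ x → sum (λ y → ⟦ within G D x y ⟧))
      ≡⟨ sum-cong-≗ (λ x → sum-cong-≗ (λ y → cong ⟦_⟧ (Iso⇒within D x y))) ⟩
    sum (λ x → sum (λ y → ⟦ distT (φ x) (φ y) ≤ᵇ D ⟧))
      ≡⟨ sum-cong-≗ (λ x → sum-↔ t (bij rep) (λ q → ⟦ distT (φ x) q ≤ᵇ D ⟧)) ⟩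
    sum (λ x → sumT t (λ q → ⟦ distT (φ x) q ≤ᵇ D ⟧))
      ≡⟨ sum-↔ t (bij rep) (λ p → sumT t (λ q → ⟦ distT p q ≤ᵇ D ⟧)) ⟩
    sumT t (λ p → sumT t (λ q → ⟦ distT p q ≤ᵇ D ⟧))
      ≡⟨ sumT-near t D ⟩
    size t + (near t D + near t D)
      ≡⟨ cong (_+ (near t D + near t D)) (sym Iso⇒n≡size) ⟩
    n + (near t D + near t D) ∎
    where open ≡-Reasoning

double-injective : ∀ {m n} → m + m ≡ n + n → m ≡ n
double-injective {zero}  {zero}  _ = refl
double-injective {suc m} {suc n} e = cong suc (double-injective
  (suc-injective (trans (sym (+-suc m m)) (trans (suc-injective e) (+-suc n n)))))

toGraph : (t : Tree) → Graph (size t)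
toGraph t = record
  { adj    = λ x y → adjT t (to (enumerate t) x) (to (enumerate t) y)
  ; sym    = λ x y → adjT-sym t _ _
  ; irrefl = λ x → adjT-irrefl t _ }

toGraph-iso : ∀ t → Iso (adj (toGraph t)) (adjT t)
toGraph-iso t = iso (enumerate t) λ _ _ → refl

-- The graph of s is represented by s and by t. Each invariant is computed in that graph through
-- both representations, which avoids following rearrangements of trees.
module _ {s t} (e : s ≈ᵀ t) where
  private
    rep = Iso-trans (toGraph-iso s) e

  size-≈ᵀ : size s ≡ size t
  size-≈ᵀ = Iso⇒n≡size (toGraph s) t rep

  pendents-≈ᵀ : pendents s ≡ pendents t
  pendents-≈ᵀ = trans (sym (Iso⇒pendentCount (toGraph s) s (toGraph-iso s))) (Iso⇒pendentCount (toGraph s) t rep)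

  near-≈ᵀ : ∀ D → near s D ≡ near t D
  near-≈ᵀ D = double-injective (+-cancelˡ-≡ (size s) _ _
    (trans (sym (Iso⇒sum-within (toGraph s) s (toGraph-iso s) D)) (Iso⇒sum-within (toGraph s) t rep D)))

-- Extremality of balanced spiders

size-spider-≥ : ∀ {b L} → All (Within b) L → suc (length L * suc b) ≤ size (spider L)
size-spider-≥ []                                  = ≤-refl
size-spider-≥ {b} {_ ∷ L} (_∷_ {m} (b≤m , _) all) = begin
  suc (suc b + length L * suc b)    ≡⟨ cong suc (+-comm (suc b) _) ⟩
  suc (length L * suc b) + suc b    ≤⟨ +-mono-≤ (size-spider-≥ all) (s≤s b≤m) ⟩
  size (spider L) + suc m           ≡⟨ cong (size (spider L) +_) (sym (size-chain m)) ⟩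
  size (spider L) + size (chain m)  ∎
  where open ≤-Reasoning

-- Were `height B` at most b, then `height A` would be at most b + 1, and level counts bounded by
-- the leaves would give at most 2 + bk + `leaves A` vertices, fewer than 2 + k(b + 1). The spider
-- has that many: a root, k legs of at least b + 1 vertices, and one more vertex on its first leg.
tall-sides : ∀ {b L t A B} → All (Within b) L → suc (length L) ≡ pendents t → size t ≡ size (spider (suc b ∷ L)) →
  t ≈ᵀ (A ◁ B) → height A ≤ suc (height B) → suc b ≤ height B
tall-sides {b} {L} {t} {A} {B} all pend sz t≈AB A≤B = ≮⇒≥ λ B<a → contradiction (upper-size (s≤s⁻¹ B<a)) (<⇒≱ lower-size)
  where
  open ≤-Reasoning
  k = suc (length L)
  leaves-k : k ≡ leaves A + leaves B
  leaves-k = trans pend (pendents-≈ᵀ t≈AB)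
  lem₁ : ∀ l b → 2 + suc l * suc b ≡ suc (l * suc b) + suc (suc b)
  lem₁ = solve-∀
  lem₂ : ∀ b x y → suc (suc b * x) + suc (b * y) ≡ 2 + b * (x + y) + x
  lem₂ = solve-∀
  lem₃ : ∀ b k → 2 + b * k + k ≡ 2 + k * suc b
  lem₃ = solve-∀
  upper-size : height B ≤ b → 2 + k * suc b ≤ 2 + b * k + leaves A
  upper-size B≤b = begin
    2 + k * suc b                                            ≡⟨ lem₁ (length L) b ⟩
    suc (length L * suc b) + suc (suc b)                     ≤⟨ +-mono-≤ (size-spider-≥ all) (≤-reflexive (sym (size-chain (suc b)))) ⟩
    size (spider (suc b ∷ L))                                ≡⟨ trans (sym sz) (size-≈ᵀ t≈AB) ⟩
    size A + size B                                          ≤⟨ +-mono-≤ (size≤ A) (size≤ B) ⟩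
    suc (height A * leaves A) + suc (height B * leaves B)    ≤⟨ +-mono-≤ (s≤s (*-monoˡ-≤ (leaves A) (≤-trans A≤B (s≤s B≤b)))) (s≤s (*-monoˡ-≤ (leaves B) B≤b)) ⟩
    suc (suc b * leaves A) + suc (b * leaves B)              ≡⟨ lem₂ b (leaves A) (leaves B) ⟩
    2 + b * (leaves A + leaves B) + leaves A                 ≡⟨ cong (λ x → 2 + b * x + leaves A) (sym leaves-k) ⟩
    2 + b * k + leaves A                                     ∎
  lower-size : 2 + b * k + leaves A < 2 + k * suc b
  lower-size = begin-strict
    2 + b * k + leaves A              <⟨ +-monoʳ-< (2 + b * k) (m<m+n (leaves A) (leaves-pos B)) ⟩
    2 + b * k + (leaves A + leaves B) ≡⟨ cong (2 + b * k +_) (sym leaves-k) ⟩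
    2 + b * k + k                     ≡⟨ lem₃ b k ⟩
    2 + k * suc b                     ∎

near-zero : ∀ t → near t 0 ≡ 0
near-zero •       = refl
near-zero (A ◁ B) = cong₂ (λ x y → x + y + 0) (near-zero A) (near-zero B)

positive : ∀ {x} → 1 ≤ x → ∃[ y ] x ≡ suc y
positive {suc y} _ = y , refl

2≤size : ∀ {b L} t → All (Within b) L → size t ≡ size (spider (suc b ∷ L)) → 2 ≤ size t
2≤size {b} t all sz = subst (2 ≤_) (sym sz) (+-mono-≤ (≤-trans (s≤s z≤n) (size-spider-≥ all))
  (≤-trans (s≤s z≤n) (≤-reflexive (sym (size-chain (suc b))))))

-- The number k is kept apart from `pendents s`: the induction takes it to be the number of legs,
-- and a spider with one leg has two pendent vertices.
Extremal : Tree → ℕ → Set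
Extremal s k = ∀ t → size t ≡ size s → pendents t ≡ k → ∀ D → near t D ≤ near s D

-- Contracting an edge of t is compared with shortening a leg of the spider.
module Contraction {b} {L : List ℕ} (all : All (Within b) L)
  (extremal : Extremal (spider (b ∷ L)) (suc (length L)))
  (t : Tree) (sz : size t ≡ size (spider (suc b ∷ L))) (pend : pendents t ≡ suc (length L))
  {A B : Tree} (t≈AB : t ≈ᵀ (A ◁ B)) (B≤A : height B ≤ height A) (A≤B : height A ≤ suc (height B))
  {p q} (lA : leaves A ≡ suc p) (lB : leaves B ≡ suc q) where

  a≤B : suc b ≤ height B
  a≤B = tall-sides all (sym pend) sz t≈AB A≤B

  a≤A : suc b ≤ height A
  a≤A = ≤-trans a≤B B≤A

  leaves-AB : leaves A + leaves B ≡ suc (length L)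
  leaves-AB = trans (sym (pendents-≈ᵀ t≈AB)) pend

  length-L : length L ≡ suc (p + q)
  length-L = suc-injective (trans (sym leaves-AB) (trans (cong₂ _+_ lA lB) (cong suc (+-suc p q))))

  size-AB : size A + size B ≡ size (spider L) + size (chain (suc b))
  size-AB = trans (sym (size-≈ᵀ t≈AB)) sz

  near-merge≤ : ∀ D → near (merge A B) D ≤ near (spider (b ∷ L)) D
  near-merge≤ = extremal (merge A B)
    (suc-injective (trans (size-merge A B) (trans size-AB (sym (size-merge (spider L) (chain (suc b)))))))
    (trans (pendents-merge A B (≤-trans (s≤s z≤n) a≤A) (≤-trans (s≤s z≤n) a≤B)) leaves-AB)

  near≤ : ∀ D → near t D ≤ near (spider (suc b ∷ L)) D
  near≤ zero    = ≤-reflexive (trans (near-zero t) (sym (near-zero (spider (suc b ∷ L)))))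
  -- Shortening the leg of the spider costs at least the linear bound up to d = 2a and at least n -
  -- 1 beyond, so t is estimated by the same one in each range.
  near≤ (suc d) with d ≤? suc b + suc b
  ... | yes d≤ = begin
    near t (suc d)                                          ≡⟨ near-≈ᵀ t≈AB (suc d) ⟩
    near (A ◁ B) (suc d)                                    ≤⟨ near-contract-≤ A B lA lB a≤A a≤B d ⟩
    near (merge A B) (suc d) + suc (d + (p + q) * (d ∸ suc b)) ≤⟨ +-monoˡ-≤ _ (near-merge≤ (suc d)) ⟩
    near (spider (b ∷ L)) (suc d) + suc (d + (p + q) * (d ∸ suc b)) ≤⟨ near-contract-spider all length-L d≤ ⟩
    near (spider (suc b ∷ L)) (suc d)                       ∎
    where open ≤-Reasoning
  ... | no  d≰ with positive (≤-trans (≤-trans (s≤s z≤n) (depth<size (root A))) (m≤m+n (size A) (size B)))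
  ...   | N , eq = begin
    near t (suc d)                    ≡⟨ near-≈ᵀ t≈AB (suc d) ⟩
    near (A ◁ B) (suc d)              ≤⟨ near-contract-≤-size A B eq d ⟩
    near (merge A B) (suc d) + N      ≤⟨ +-monoˡ-≤ N (near-merge≤ (suc d)) ⟩
    near (spider (b ∷ L)) (suc d) + N ≤⟨ near-contract-spider-size all (trans (sym size-AB) eq) (≰⇒> d≰) ⟩
    near (spider (suc b ∷ L)) (suc d) ∎
    where open ≤-Reasoning

  -- Since `merge A B` stays below the shortened spider, t can equal the spider only if its own drop
  -- is as large as the spider's.
  attained : ∀ {d N} → d ≤ suc b + suc b → suc (d + (p + q) * (d ∸ suc b)) ≡ N →
    near t (suc d) ≡ near (spider (suc b ∷ L)) (suc d) → near (merge A B) (suc d) + N ≤ near (A ◁ B) (suc d)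
  attained {d} d≤ refl eq = begin
    near (merge A B) (suc d) + suc (d + (p + q) * (d ∸ suc b)) ≤⟨ +-monoˡ-≤ _ (near-merge≤ (suc d)) ⟩
    near (spider (b ∷ L)) (suc d) + suc (d + (p + q) * (d ∸ suc b)) ≤⟨ near-contract-spider all length-L d≤ ⟩
    near (spider (suc b ∷ L)) (suc d)                       ≡⟨ trans (sym eq) (near-≈ᵀ t≈AB (suc d)) ⟩
    near (A ◁ B) (suc d)                                    ∎
    where open ≤-Reasoning

  rigid : 2 ≤ length L →
    near t 2 ≡ near (spider (suc b ∷ L)) 2 →
    near t (suc (suc b + suc b)) ≡ near (spider (suc b ∷ L)) (suc (suc b + suc b)) →
    ∃[ L′ ] All (Within b) L′ × t ≈ᵀ spider (suc b ∷ L′)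
  rigid 2≤k eq₂ eq = build (tight⇒spiderChain A B lA lB a≤B B≤A A≤B
      (attained ≤-refl (cong (λ x → suc (suc b + suc b + (p + q) * x)) (m+n∸n≡m (suc b) (suc b))) eq)
      (s≤s⁻¹ (subst (2 ≤_) length-L 2≤k))
      -- For d = 1 the bound is 2, because 1 ∸ (b + 1) = 0.
      (attained (s≤s z≤n) (cong (2 +_) (trans (cong ((p + q) *_) (0∸n≡0 b)) (*-zeroʳ (p + q)))) eq₂))
    where
    build : SpiderChain b A B ⊎ SpiderChain b B A → ∃[ L′ ] All (Within b) L′ × t ≈ᵀ spider (suc b ∷ L′)
    build (inj₁ record { legs = L′ ; spiderˡ = refl ; chainʳ = refl ; legs-within = all′ }) = L′ , all′ , t≈AB
    build (inj₂ record { legs = L′ ; spiderˡ = refl ; chainʳ = refl ; legs-within = all′ }) =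
      L′ , all′ , Iso-trans t≈AB (◁-swap A B)

-- All pairs of vertices, n choose 2 in number, and the star

triangle : ℕ → ℕ
triangle zero    = 0
triangle (suc n) = n + triangle n

triangle-+ : ∀ m n → triangle (m + n) ≡ triangle m + triangle n + m * n
triangle-+ zero    n = sym (+-identityʳ _)
triangle-+ (suc m) n = trans (cong (m + n +_) (triangle-+ m n)) (lem m n (triangle m) (triangle n))
  where
  lem : ∀ m n x y → m + n + (x + y + m * n) ≡ m + x + y + suc m * n
  lem m n x y = lem′ m n x y (m * n)
    where
    lem′ : ∀ m n x y z → m + n + (x + y + z) ≡ m + x + y + (n + z)
    lem′ = solve-∀

conv≤ : ∀ f g {c} → (∀ n → S g n ≤ c) → ∀ D → conv f g D ≤ S f D * c
conv≤ f g     le zero    = z≤n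
conv≤ f g {c} le (suc D) = begin
  f 0 * S g (suc D) + conv (f ∘ suc) g D ≤⟨ +-mono-≤ (*-monoʳ-≤ (f 0) (le (suc D))) (conv≤ (f ∘ suc) g le D) ⟩
  f 0 * c + S (f ∘ suc) D * c            ≡⟨ sym (*-distribʳ-+ c (f 0) _) ⟩
  (f 0 + S (f ∘ suc) D) * c              ≡⟨ cong (_* c) (sym (S-start f D)) ⟩
  S f (suc D) * c                        ∎
  where open ≤-Reasoning

near≤triangle : ∀ t D → near t D ≤ triangle (size t)
near≤triangle •       D = z≤n
near≤triangle (A ◁ B) D = ≤-trans
  (+-mono-≤ (+-mono-≤ (near≤triangle A D) (near≤triangle B D))
    (≤-trans (conv≤ (level A) (level B) (S-level≤size B) D) (*-monoˡ-≤ (size B) (S-level≤size A D))))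
  (≤-reflexive (sym (triangle-+ (size A) (size B))))

near-one : ∀ t → suc (near t 1) ≡ size t
near-one •       = refl
near-one (A ◁ B) rewrite level-zero A | level-zero B =
  trans (lem (near A 1) (near B 1)) (cong₂ _+_ (near-one A) (near-one B))
  where
  lem : ∀ x y → suc (x + y + 1) ≡ suc x + suc y
  lem = solve-∀

near-star : ∀ m D → near (spider (replicate m 0)) (2 + D) ≡ triangle (size (spider (replicate m 0)))
near-star zero    D = refl
near-star (suc m) D = begin
  near X (2 + D) + 0 + conv (level X) (level •) (2 + D)
    ≡⟨ cong₂ _+_ (trans (+-identityʳ _) (near-star m D)) (conv-startʳ (level X) (level •) (suc D)) ⟩
  triangle (size X) + (1 * S (level X) (2 + D) + conv (level X) (λ _ → 0) (suc D))
    ≡⟨ cong (triangle (size X) +_) (cong₂ _+_ (trans (*-identityˡ _) (S-level≡size X {2 + D} (s≤s (≤-trans (height-star m) (s≤s z≤n)))))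
         (conv-zeroʳ (level X) (suc D))) ⟩
  triangle (size X) + (size X + 0)
    ≡⟨ lem (triangle (size X)) (size X) ⟩
  size X + triangle (size X)
    ≡⟨ cong triangle (+-comm 1 (size X)) ⟩
  triangle (size X + 1) ∎
  where
  open ≡-Reasoning
  X = spider (replicate m 0)
  height-star : ∀ m → height (spider (replicate m 0)) ≤ 1
  height-star zero    = z≤n
  height-star (suc m) = ⊔-lub (height-star m) ≤-refl
  lem : ∀ x y → x + (y + 0) ≡ y + x
  lem = solve-∀

-- Balanced spiders: induction and uniqueness

otherLegs : ℕ → ℕ → ℕ → List ℕ
otherLegs b s u = replicate s (suc b) ++ replicate u b

-- For a = b + 1 this computes to `suc b ∷ otherLegs b s u`: a longest leg stands in front, ready to
-- be shortened.
legs : ℕ → ℕ → ℕ → List ℕ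
legs a s u = replicate (suc s) a ++ replicate u (pred a)

-- s + 1 legs with a + 1 vertices and u legs with a vertices.
balanced : ℕ → ℕ → ℕ → Tree
balanced a s u = spider (legs a s u)

within-otherLegs : ∀ b x y → All (Within b) (otherLegs b x y)
within-otherLegs b x y = ++⁺ (replicate⁺ x (n≤1+n b , ≤-refl)) (replicate⁺ y (≤-refl , n≤1+n b))

length-otherLegs : ∀ b x y → length (otherLegs b x y) ≡ x + y
length-otherLegs b x y = trans (length-++ (replicate x (suc b))) (cong₂ _+_ (length-replicate x) (length-replicate y))

Extremal-≈ : ∀ {s s′ k} → s ≈ᵀ s′ → Extremal s k → Extremal s′ k
Extremal-≈ e ext t sz pend D = subst (near t D ≤_) (near-≈ᵀ e D) (ext t (trans sz (sym (size-≈ᵀ e))) pend D)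

-- Shortening a leg of a balanced spider leaves a balanced spider.
shorten-zero : ∀ b u → Extremal (balanced b u 0) (suc u + 0) → Extremal (spider (b ∷ otherLegs b 0 u)) (suc u)
shorten-zero b u ext = subst (λ L → Extremal (spider L) (suc u)) (++-identityʳ (replicate (suc u) b))
  (subst (Extremal (balanced b u 0)) (cong suc (+-identityʳ u)) ext)

shorten-suc : ∀ b s u → Extremal (balanced (suc b) s (suc u)) (suc s + suc u) →
  Extremal (spider (b ∷ otherLegs b (suc s) u)) (suc (suc s + u))
shorten-suc b s u ext = Extremal-≈ (unrooted (spider-↭ (shift b (replicate (suc s) (suc b)) (replicate u b))))
  (subst (Extremal (balanced (suc b) s (suc u))) (cong suc (+-suc s u)) ext)

lengthen : ∀ b s u → Extremal (spider (b ∷ otherLegs b s u)) (suc (s + u)) → Extremal (balanced (suc b) s u) (suc (s + u))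
lengthen b s u ext t sz pend with hasCentralEdge t (2≤size t (within-otherLegs b s u) sz)
... | c = Contraction.near≤ (within-otherLegs b s u)
  (subst (Extremal (spider (b ∷ otherLegs b s u))) (cong suc (sym (length-otherLegs b s u))) ext) t sz
  (trans pend (cong suc (sym (length-otherLegs b s u)))) (CentralEdge.t≈AB c) (CentralEdge.B≤A c) (CentralEdge.A≤B c)
  (proj₂ (positive (leaves-pos (CentralEdge.A c)))) (proj₂ (positive (leaves-pos (CentralEdge.B c))))

-- For D = 1 the count is the number of edges, fixed by the size; from D = 2 on the star counts
-- every pair.
star-extremal : ∀ s → Extremal (balanced 0 s 0) (suc s + 0)
star-extremal s t sz pend zero          = ≤-reflexive (trans (near-zero t) (sym (near-zero (balanced 0 s 0))))
star-extremal s t sz pend (suc zero)    = ≤-reflexive (suc-injective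
  (trans (near-one t) (trans sz (sym (near-one (balanced 0 s 0))))))
star-extremal s t sz pend (suc (suc D)) = ≤-trans (near≤triangle t (2 + D)) (≤-reflexive
  (trans (cong triangle sz) (subst (λ L → triangle (size (spider L)) ≡ near (spider L) (2 + D))
    (sym (++-identityʳ (replicate (suc s) 0))) (sym (near-star (suc s) D)))))

-- Shortening leads from (a, s + 1, u) to (a, s, u + 1), and from (b + 1, 0, u) to (b, u, 0), so the
-- recursion is lexicographic in a and s. For a = 0 the u shorter legs would have no vertices, while
-- `pred 0` would give them one; the side condition excludes this.
balanced-extremal : ∀ a s u → 1 ≤ a ⊎ u ≡ 0 → Extremal (balanced a s u) (suc (s + u))
balanced-extremal zero    s       zero    _ = star-extremal s
balanced-extremal zero    s       (suc u) (inj₁ ())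
balanced-extremal zero    s       (suc u) (inj₂ ())
balanced-extremal (suc b) zero    u       _ = lengthen b zero u (shorten-zero b u (balanced-extremal b u 0 (inj₂ refl)))
balanced-extremal (suc b) (suc s) u       _ =
  lengthen b (suc s) u (shorten-suc b s u (balanced-extremal (suc b) s (suc u) (inj₁ (s≤s z≤n))))

shortened-extremal : ∀ b s u → Extremal (spider (b ∷ otherLegs b s u)) (suc (s + u))
shortened-extremal b zero    u = shorten-zero b u (balanced-extremal b u 0 (inj₂ refl))
shortened-extremal b (suc s) u = shorten-suc b s u (balanced-extremal (suc b) s (suc u) (inj₁ (s≤s z≤n)))

sort-within : ∀ {b L} → All (Within b) L → ∃[ x ] ∃[ y ] L ↭ otherLegs b x y
sort-within [] = 0 , 0 , ↭.refl
sort-within {b} {m ∷ _} ((b≤m , m≤b) ∷ all) with sort-within all | m≤n⇒m<n∨m≡n b≤m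
... | x , y , e | inj₁ b<m rewrite ≤-antisym m≤b b<m = suc x , y , ↭.prep (suc b) e
... | x , y , e | inj₂ refl = x , suc y , ↭.trans (↭.prep b e) (↭.↭-sym (shift b (replicate x (suc b)) (replicate y b)))

size-spider-replicate : ∀ x c L → size (spider (replicate x c ++ L)) ≡ x * suc c + size (spider L)
size-spider-replicate zero    c L = refl
size-spider-replicate (suc x) c L = trans (cong₂ _+_ (size-spider-replicate x c L) (size-chain c))
  (lem (x * suc c) (size (spider L)) (suc c))
  where
  lem : ∀ p q r → p + q + r ≡ r + p + q
  lem = solve-∀

-- With x long and y short legs, the length is x + y and the size is 1 + (x + y)(b + 1) + x, so both
-- multiplicities are determined.
within-unique : ∀ {b L L′} → All (Within b) L → All (Within b) L′ →
  length L ≡ length L′ → size (spider L) ≡ size (spider L′) → L ↭ L′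
within-unique {b} {L} {L′} all all′ len sz with sort-within all | sort-within all′
... | x , y , e | x′ , y′ , e′ = ↭.trans e (↭.trans (↭.↭-reflexive (cong₂ (otherLegs b) x≡x′ y≡y′)) (↭.↭-sym e′))
  where
  lengths : x + y ≡ x′ + y′
  lengths = trans (sym (trans (↭-length e) (length-otherLegs b x y)))
    (trans len (trans (↭-length e′) (length-otherLegs b x′ y′)))
  size-sorted : ∀ {L} x y → L ↭ otherLegs b x y → size (spider L) ≡ suc ((x + y) * suc b) + x
  size-sorted {L} x y e = begin
    size (spider L)                                        ≡⟨ size-≈ᵀ (unrooted (spider-↭ e)) ⟩
    size (spider (otherLegs b x y))   ≡⟨ size-spider-replicate x (suc b) (replicate y b) ⟩
    x * (2 + b) + size (spider (replicate y b))            ≡⟨ cong (λ L → x * (2 + b) + size (spider L)) (sym (++-identityʳ (replicate y b))) ⟩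
    x * (2 + b) + size (spider (replicate y b ++ []))      ≡⟨ cong (x * (2 + b) +_) (size-spider-replicate y b []) ⟩
    x * (2 + b) + (y * suc b + 1)                          ≡⟨ lem x y b ⟩
    suc ((x + y) * suc b) + x                              ∎
    where
    open ≡-Reasoning
    lem : ∀ x y b → x * (2 + b) + (y * suc b + 1) ≡ suc ((x + y) * suc b) + x
    lem = solve-∀
  x≡x′ : x ≡ x′
  x≡x′ = +-cancelˡ-≡ (suc ((x + y) * suc b)) _ _ (trans (sym (size-sorted x y e)) (trans sz
    (trans (size-sorted x′ y′ e′) (cong (λ l → suc (l * suc b) + x′) (sym lengths)))))
  y≡y′ : y ≡ y′
  y≡y′ = +-cancelˡ-≡ x _ _ (trans lengths (cong (_+ y′) (sym x≡x′)))

pendents-spider : ∀ m L → 1 ≤ length L → pendents (spider (m ∷ L)) ≡ suc (length L)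
pendents-spider m (m′ ∷ L) _ = trans (cong₂ _+_ (nonRootLeaves-spider (m′ ∷ L)) (leaves-chain m)) (+-comm _ 1)

balanced-unique : ∀ b s u → 2 ≤ s + u → ∀ t → size t ≡ size (balanced (suc b) s u) → pendents t ≡ suc (s + u) →
  (∀ D → near t D ≡ near (balanced (suc b) s u) D) → t ≈ᵀ balanced (suc b) s u
balanced-unique b s u 2≤k t sz pend eq
  with hasCentralEdge t (2≤size t (within-otherLegs b s u) sz)
... | c with Contraction.rigid (within-otherLegs b s u)
         (subst (Extremal (spider (b ∷ otherLegs b s u))) (cong suc (sym (length-otherLegs b s u))) (shortened-extremal b s u)) t sz
         (trans pend (cong suc (sym (length-otherLegs b s u))))
         (CentralEdge.t≈AB c) (CentralEdge.B≤A c) (CentralEdge.A≤B c)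
         (proj₂ (positive (leaves-pos (CentralEdge.A c)))) (proj₂ (positive (leaves-pos (CentralEdge.B c))))
         (subst (2 ≤_) (sym (length-otherLegs b s u)) 2≤k) (eq 2) (eq _)
... | L′ , all′ , e = Iso-trans e (unrooted (spider-↭ (↭.prep (suc b)
    (within-unique all′ (within-otherLegs b s u) lengths
      (+-cancelʳ-≡ (size (chain (suc b))) _ _ (trans (sym (size-≈ᵀ e)) sz))))))
  where
  len = length-otherLegs b s u
  lengths : length L′ ≡ length (otherLegs b s u)
  lengths = trans (count L′ (trans (sym (pendents-≈ᵀ e)) pend)) (sym len)
    where
    count : ∀ L → pendents (spider (suc b ∷ L)) ≡ suc (s + u) → length L ≡ s + u
    -- Without further legs the tree is a path with two pendent vertices, against s + u ≥ 2.
    count []      eq = contradiction (subst (2 ≤_) (suc-injective (sym (trans (sym (cong suc (leaves-chain b))) eq))) 2≤k) 1+n≰n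
    count (m ∷ L) eq = suc-injective (trans (sym (pendents-spider (suc b) (m ∷ L) (s≤s z≤n))) eq)

-- Abel summation of the Harary index

infixl 7 _·_
_·_ : ℕ → ℚ → ℚ
zero  · w = 0ℚ
suc m · w = w ℚ.+ m · w

·-distrib : ∀ m n w → (m + n) · w ≡ m · w ℚ.+ n · w
·-distrib zero    n w = sym (ℚ.+-identityˡ _)
·-distrib (suc m) n w = trans (cong (w ℚ.+_) (·-distrib m n w)) (sym (ℚ.+-assoc w _ _))

1· : ∀ w → 1 · w ≡ w
1· w = ℚ.+-identityʳ w

0≤· : ∀ n {w} → 0ℚ ℚ.≤ w → 0ℚ ℚ.≤ n · w
0≤· zero    0≤w = ℚ.≤-refl
0≤· (suc n) 0≤w = ℚ.+-mono-≤ 0≤w (0≤· n 0≤w)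

·-mono : ∀ {m n w} → 0ℚ ℚ.≤ w → m ≤ n → m · w ℚ.≤ n · w
·-mono {n = n} 0≤w z≤n       = 0≤· n 0≤w
·-mono {w = w} 0≤w (s≤s m≤n) = ℚ.+-monoʳ-≤ w (·-mono 0≤w m≤n)

·-injective : ∀ m n {w} → 0ℚ ℚ.< w → m ≤ n → m · w ≡ n · w → m ≡ n
·-injective zero zero 0<w _ _ = refl
·-injective zero (suc n) {w} 0<w _ e = contradiction e (ℚ.<⇒≢ (ℚ.+-mono-<-≤ 0<w (0≤· n (ℚ.<⇒≤ 0<w))))
·-injective (suc m) (suc n) {w} 0<w (s≤s m≤n) e =
  cong suc (·-injective m n 0<w m≤n (ℚ-+-cancelˡ w _ _ e))
  where
  open import Algebra.Properties.Group ℚ.+-0-group using () renaming (∙-cancelˡ to ℚ-+-cancelˡ)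

+-squeeze : ∀ {a a′ b b′} → a ℚ.≤ a′ → b ℚ.≤ b′ → a ℚ.+ b ≡ a′ ℚ.+ b′ → a ≡ a′ × b ≡ b′
+-squeeze {a} {a′} {b} {b′} a≤a′ b≤b′ e =
    ℚ.≤-antisym a≤a′ (ℚ.≮⇒≥ (λ a<a′ → ℚ.<-irrefl e (ℚ.+-mono-<-≤ a<a′ b≤b′)))
  , ℚ.≤-antisym b≤b′ (ℚ.≮⇒≥ (λ b<b′ → ℚ.<-irrefl e (ℚ.+-mono-≤-< a≤a′ b<b′)))

recip-anti : ∀ m → recip (2 + m) ℚ.< recip (suc m)
recip-anti m = ℚ.toℚᵘ-cancel-< (begin-strict
  ℚ.toℚᵘ (recip (2 + m)) ≃⟨ ℚ.toℚᵘ-fromℚᵘ (ℚᵘ.mkℚᵘ (ℤ.+ 1) (suc m)) ⟩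
  ℚᵘ.mkℚᵘ (ℤ.+ 1) (suc m)  <⟨ ℚᵘ.*<* (ℤ.+<+ ≤-refl) ⟩
  ℚᵘ.mkℚᵘ (ℤ.+ 1) m        ≃⟨ ℚᵘ.≃-sym (ℚ.toℚᵘ-fromℚᵘ (ℚᵘ.mkℚᵘ (ℤ.+ 1) m)) ⟩
  ℚ.toℚᵘ (recip (suc m)) ∎)
  where
  open ℚᵘ.≤-Reasoning

0<recip : ∀ m → 0ℚ ℚ.< recip (suc m)
0<recip m = ℚ.toℚᵘ-cancel-< (ℚᵘ.<-respʳ-≃ (ℚᵘ.≃-sym (ℚ.toℚᵘ-fromℚᵘ (ℚᵘ.mkℚᵘ (ℤ.+ 1) m)))
  (ℚᵘ.*<* (ℤ.+<+ (s≤s z≤n))))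

weight : ℕ → ℚ
weight m = recip (suc m) ℚ.- recip (2 + m)

0<weight : ∀ m → 0ℚ ℚ.< weight m
0<weight m = subst (ℚ._< weight m) (ℚ.+-inverseʳ (recip (2 + m))) (ℚ.+-monoˡ-< (ℚ.- recip (2 + m)) (recip-anti m))

-- Abel summation: if v D counts the pairs at distance at most D, then
-- weighted N v + v (N + 1) · 1/(N + 1) is the sum of 1/d over these pairs.
weighted : ℕ → (ℕ → ℕ) → ℚ
weighted zero    v = 0ℚ
weighted (suc n) v = weighted n v ℚ.+ v (suc n) · weight n

abel : ℕ → (ℕ → ℕ) → ℚ
abel n v = weighted n v ℚ.+ v (suc n) · recip (suc n)

weighted-cong : ∀ n {u v} → (∀ D → u D ≡ v D) → weighted n u ≡ weighted n v
weighted-cong zero    e = refl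
weighted-cong (suc n) e = cong₂ (λ x y → x ℚ.+ y · weight n) (weighted-cong n e) (e (suc n))

abel-cong : ∀ n {u v} → (∀ D → u D ≡ v D) → abel n u ≡ abel n v
abel-cong n e = cong₂ (λ x y → x ℚ.+ y · recip (suc n)) (weighted-cong n e) (e (suc n))

ℚ-interchange : ∀ a b c d → a ℚ.+ b ℚ.+ (c ℚ.+ d) ≡ a ℚ.+ c ℚ.+ (b ℚ.+ d)
ℚ-interchange = interchange
  where open import Algebra.Properties.CommutativeSemigroup (CommutativeMonoid.commutativeSemigroup ℚ.+-0-commutativeMonoid)

weighted-+ : ∀ n u v → weighted n (λ D → u D + v D) ≡ weighted n u ℚ.+ weighted n v
weighted-+ zero    u v = sym (ℚ.+-identityˡ 0ℚ)
weighted-+ (suc n) u v = trans (cong₂ ℚ._+_ (weighted-+ n u v) (·-distrib (u (suc n)) (v (suc n)) (weight n)))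
  (ℚ-interchange (weighted n u) _ _ _)

abel-+ : ∀ n u v → abel n (λ D → u D + v D) ≡ abel n u ℚ.+ abel n v
abel-+ n u v = trans (cong₂ ℚ._+_ (weighted-+ n u v) (·-distrib (u (suc n)) (v (suc n)) (recip (suc n))))
  (ℚ-interchange (weighted n u) _ _ _)

weighted-0 : ∀ n {v} → (∀ D → D ≤ n → v D ≡ 0) → weighted n v ≡ 0ℚ
weighted-0 zero    e = refl
weighted-0 (suc n) e = trans (cong₂ (λ x y → x ℚ.+ y · weight n)
  (weighted-0 n (λ D D≤n → e D (≤-trans D≤n (n≤1+n n)))) (e (suc n) ≤-refl)) (ℚ.+-identityˡ 0ℚ)

abel-0 : ∀ n → abel n (λ _ → 0) ≡ 0ℚ
abel-0 n = trans (ℚ.+-identityʳ _) (weighted-0 n (λ _ _ → refl))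

weighted-mono : ∀ n {u v} → (∀ D → u D ≤ v D) → weighted n u ℚ.≤ weighted n v
weighted-mono zero    le = ℚ.≤-refl
weighted-mono (suc n) le = ℚ.+-mono-≤ (weighted-mono n le) (·-mono (ℚ.<⇒≤ (0<weight n)) (le (suc n)))

abel-mono : ∀ n {u v} → (∀ D → u D ≤ v D) → abel n u ℚ.≤ abel n v
abel-mono n le = ℚ.+-mono-≤ (weighted-mono n le) (·-mono (ℚ.<⇒≤ (0<recip n)) (le (suc n)))

weighted-injective : ∀ n {u v} → (∀ D → u D ≤ v D) → weighted n u ≡ weighted n v → ∀ D → D < n → u (suc D) ≡ v (suc D)
weighted-injective (suc n) {u} {v} le e D D<n
  with +-squeeze (weighted-mono n le) (·-mono (ℚ.<⇒≤ (0<weight n)) (le (suc n))) e | m≤n⇒m<n∨m≡n (s≤s⁻¹ D<n)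
... | e′ , _  | inj₁ D<n′ = weighted-injective n le e′ D D<n′
... | _  , e′ | inj₂ refl = ·-injective (u (suc n)) (v (suc n)) (0<weight n) (le (suc n)) e′

-- All weights 1/D - 1/(D + 1) are positive, so no term can fall short without another exceeding its
-- bound.
abel-injective : ∀ n {u v} → (∀ D → u D ≤ v D) → abel n u ≡ abel n v → ∀ D → D < n → u (suc D) ≡ v (suc D)
abel-injective n le e = weighted-injective n le
  (proj₁ (+-squeeze (weighted-mono n le) (·-mono (ℚ.<⇒≤ (0<recip n)) (le (suc n))) e))

-- For one pair at distance d the indicator vanishes before d; from there on the weights telescope
-- to 1/d.
abel-recip : ∀ n d → 1 ≤ d → d ≤ suc n → abel n (λ D → ⟦ d ≤ᵇ D ⟧) ≡ recip d
abel-recip n d 1≤d d≤ with m≤n⇒m<n∨m≡n d≤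
abel-recip n d 1≤d d≤ | inj₂ refl = trans (cong₂ (λ x b → x ℚ.+ ⟦ b ⟧ · recip (suc n))
  (weighted-0 n (λ D D≤n → cong ⟦_⟧ (≰⇒≤ᵇ≡false (<⇒≱ (s≤s D≤n))))) (≤⇒≤ᵇ≡true (≤-refl {suc n})))
  (trans (ℚ.+-identityˡ _) (1· (recip (suc n))))
  where
  ≰⇒≤ᵇ≡false : ∀ {m n} → ¬ m ≤ n → (m ≤ᵇ n) ≡ false
  ≰⇒≤ᵇ≡false {m} {n} ≰ with m ≤ᵇ n in eq
  ... | true  = contradiction (≤ᵇ≡true⇒≤ eq) ≰
  ... | false = refl
abel-recip zero    d 1≤d d≤ | inj₁ (s≤s d≤0) = contradiction (≤-trans 1≤d d≤0) λ ()
abel-recip (suc n) d 1≤d d≤ | inj₁ (s≤s d≤n) = trans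
  (cong₂ (λ a b → weighted n v ℚ.+ ⟦ a ⟧ · weight n ℚ.+ ⟦ b ⟧ · recip (2 + n)) (≤⇒≤ᵇ≡true d≤n) (≤⇒≤ᵇ≡true d≤))
  (trans (cong₂ (λ x y → weighted n v ℚ.+ x ℚ.+ y) (1· (weight n)) (1· (recip (2 + n))))
  (trans (ℚ.+-assoc (weighted n v) (weight n) (recip (2 + n)))
  (trans (cong (weighted n v ℚ.+_) (trans (ℚ.+-assoc (recip (suc n)) _ _)
            (trans (cong (recip (suc n) ℚ.+_) (ℚ.+-inverseˡ (recip (2 + n)))) (trans (ℚ.+-identityʳ _) (sym (1· (recip (suc n))))))))
  (trans (cong (λ a → weighted n v ℚ.+ ⟦ a ⟧ · recip (suc n)) (sym (≤⇒≤ᵇ≡true d≤n)))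
    (abel-recip n d 1≤d d≤n)))))
  where v = λ D → ⟦ d ≤ᵇ D ⟧

foldr-abel : ∀ N {A : Set} (f : A → ℚ) (g : A → ℕ → ℕ) → (∀ x → f x ≡ abel N (g x)) → ∀ xs →
  foldr ℚ._+_ 0ℚ (map f xs) ≡ abel N (λ D → ListAction.sum (map (λ x → g x D) xs))
foldr-abel N f g e []       = sym (abel-0 N)
foldr-abel N f g e (x ∷ xs) = trans (cong₂ ℚ._+_ (e x) (foldr-abel N f g e xs))
  (sym (abel-+ N (g x) (λ D → ListAction.sum (map (λ x → g x D) xs))))

-- N is left free above n - 1 so that, by taking it large, equality of Harary indices can be read
-- off at any prescribed D.
harary-abel : ∀ {n} (G : Graph n) t → Iso (adj G) (adjT t) → ∀ N → n ≤ suc N → harary G ≡ abel N (near t)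
harary-abel {n} G t rep N n≤N = trans
  (foldr-abel N _ (λ x D → ListAction.sum (map (λ y → pair x y D) (allFin n)))
    (λ x → foldr-abel N _ (pair x) (entry x) (allFin n)) (allFin n))
  (abel-cong N counts)
  where
  δ : Fin n → Fin n → ℕ
  δ x y = distT (to (bij rep) x) (to (bij rep) y)
  pair : Fin n → Fin n → ℕ → ℕ
  pair x y D = if toℕ x <ᵇ toℕ y then ⟦ δ x y ≤ᵇ D ⟧ else 0
  δ-pos : ∀ {x y} → (toℕ x <ᵇ toℕ y) ≡ true → 1 ≤ δ x y
  δ-pos {x} {y} lt = n≢0⇒n>0 (λ δ≡0 → <⇒≢ (<ᵇ⇒< (toℕ x) (toℕ y) (Equivalence.from T-≡ lt)) (cong toℕ
    (trans (sym (strictlyInverseʳ (bij rep) x)) (trans (cong (from (bij rep)) (distT≡0⇒≡ _ _ δ≡0)) (strictlyInverseʳ (bij rep) y)))))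
  entry : ∀ x y → (if toℕ x <ᵇ toℕ y then recip (dist G x y) else 0ℚ) ≡ abel N (pair x y)
  entry x y with toℕ x <ᵇ toℕ y in eq
  ... | false = sym (abel-0 N)
  ... | true  = trans (cong recip (Iso⇒dist G t rep x y))
    (sym (abel-recip N (δ x y) (δ-pos eq) (≤-trans (<⇒≤ (dist<n G t rep x y)) n≤N)))
  counts : ∀ D → ListAction.sum (map (λ x → ListAction.sum (map (λ y → pair x y D) (allFin n))) (allFin n)) ≡ near t D
  counts D = begin
    ListAction.sum (map (λ x → ListAction.sum (map (λ y → pair x y D) (allFin n))) (allFin n))
      ≡⟨ listSum-allFin (λ x → ListAction.sum (map (λ y → pair x y D) (allFin n))) ⟩
    sum (λ x → ListAction.sum (map (λ y → pair x y D) (allFin n)))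
      ≡⟨ sum-cong-≗ (λ x → listSum-allFin (λ y → pair x y D)) ⟩
    upper h
      ≡⟨ double-injective (+-cancelˡ-≡ n _ _ (trans (sym (trans (sum-symmetric h h-sym)
           (cong (_+ (upper h + upper h)) diagonal))) (trans within-sum (Iso⇒sum-within G t rep D)))) ⟩
    near t D ∎
    where
    open ≡-Reasoning
    h : Fin n → Fin n → ℕ
    h x y = ⟦ δ x y ≤ᵇ D ⟧
    h-sym : ∀ x y → h x y ≡ h y x
    h-sym x y = cong (λ d → ⟦ d ≤ᵇ D ⟧) (distT-sym (to (bij rep) x) (to (bij rep) y))
    diagonal : sum (λ x → h x x) ≡ n
    diagonal = trans (sum-cong-≗ (λ x → cong (λ d → ⟦ d ≤ᵇ D ⟧) (distT-refl (to (bij rep) x))))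
      (trans (sum-const n 1) (*-identityʳ n))
    within-sum : sum (λ x → sum (h x)) ≡ sum (λ x → sum (λ y → ⟦ within G D x y ⟧))
    within-sum = sum-cong-≗ (λ x → sum-cong-≗ (λ y → cong ⟦_⟧ (sym (Iso⇒within G t rep D x y))))

-- Spanning trees of connected graphs

record Embedding {n} (t : Tree) (G : Graph n) : Set where
  field
    φ         : Pos t → Fin n
    injective : ∀ {p q} → φ p ≡ φ q → p ≡ q
    edges     : ∀ p q → adjT t p q ≡ true → adj G (φ p) (φ q) ≡ true
open Embedding

inImage? : ∀ {n t} (f : Pos t → Fin n) y → Dec (∃[ p ] f p ≡ y)
inImage? {t = t} f y with any? (λ i → f (to (enumerate t) i) Data.Fin.≟ y)
... | yes (i , e) = yes (to (enumerate t) i , e)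
... | no  ¬e      = no λ (p , e) → ¬e (from (enumerate t) p , trans (cong f (strictlyInverseˡ (enumerate t) p)) e)

to-injective : ∀ {A B : Set} (f : A ↔ B) {x y} → to f x ≡ to f y → x ≡ y
to-injective f {x} {y} e = trans (sym (strictlyInverseʳ f x)) (trans (cong (from f) e) (strictlyInverseʳ f y))

missed⇒size< : ∀ {n t} {G : Graph n} (E : Embedding t G) {y} → ¬ (∃[ p ] φ E p ≡ y) → size t < n
missed⇒size< {n} {t} E {y} missed = injective⇒≤ {f = g} (λ {i} {j} → inj i j)
  where
  g : Fin (suc (size t)) → Fin n
  g zero    = y
  g (suc i) = φ E (to (enumerate t) i)
  inj : ∀ i j → g i ≡ g j → i ≡ j
  inj zero    zero    e = refl
  inj zero    (suc j) e = contradiction (_ , sym e) missed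
  inj (suc i) zero    e = contradiction (_ , e) missed
  inj (suc i) (suc j) e = cong suc (to-injective (enumerate t) (injective E e))

size<⇒missed : ∀ {n t} {G : Graph n} (E : Embedding t G) → size t < n → ∃[ y ] ¬ (∃[ p ] φ E p ≡ y)
size<⇒missed {n} {t} E lt with any? (λ y → ¬? (inImage? (φ E) y))
... | yes missed = missed
... | no  ¬missed = contradiction (injective⇒≤ {f = λ y → from (enumerate t) (proj₁ (hit y))}
    (λ {x} {y} e → trans (sym (proj₂ (hit x))) (trans (cong (φ E) (to-injective (↔-sym (enumerate t)) e)) (proj₂ (hit y)))))
    (<⇒≱ lt)
  where
  hit : ∀ y → ∃[ p ] φ E p ≡ y
  hit y with inImage? (φ E) y
  ... | yes h = h
  ... | no ¬h = contradiction (y , ¬h) ¬missed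

⟦⟧-mono : ∀ {a b} → (a ≡ true → b ≡ true) → ⟦ a ⟧ ≤ ⟦ b ⟧
⟦⟧-mono {false} f = z≤n
⟦⟧-mono {true}  f = ≤-reflexive (sym (cong ⟦_⟧ (f refl)))

⟦⟧-injective : ∀ {a b} → ⟦ a ⟧ ≡ ⟦ b ⟧ → a ≡ b
⟦⟧-injective {true}  {true}  _ = refl
⟦⟧-injective {false} {false} _ = refl

-- A spanning tree of a graph with n - 1 edges uses all of them.
spanning⇒Iso : ∀ {n t} (G : Graph n) → edgeCount G ≡ n ∸ 1 → size t ≡ n → Embedding t G → Iso (adj G) (adjT t)
spanning⇒Iso {n} {t} G edgeCount≡ sz E = iso f λ x y →
  ⟦⟧-injective (sum-squeeze (le x) (≤-reflexive (sym (sum-squeeze (λ x → sum-mono (le x)) total x))) y)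
  where
  hit : ∀ y → ∃[ p ] φ E p ≡ y
  hit y with inImage? (φ E) y
  ... | yes h = h
  ... | no ¬h = contradiction (subst (_< n) sz (missed⇒size< E ¬h)) (n≮n n)
  f : Fin n ↔ Pos t
  f = mk↔ₛ′ (proj₁ ∘ hit) (φ E) (λ p → injective E (proj₂ (hit (φ E p)))) (proj₂ ∘ hit)
  le : ∀ x y → ⟦ adjT t (to f x) (to f y) ⟧ ≤ ⟦ adj G x y ⟧
  le x y = ⟦⟧-mono (λ e → subst (_≡ true) (cong₂ (adj G) (proj₂ (hit x)) (proj₂ (hit y))) (edges E _ _ e))
  doubled : ∀ m → 1 ≤ m → (m ∸ 1) + (m ∸ 1) + 2 ≡ m + m
  doubled (suc m) _ = lem m
    where
    lem : ∀ m → m + m + 2 ≡ suc m + suc m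
    lem = solve-∀
  total : sum (λ x → sum (λ y → ⟦ adj G x y ⟧)) ≤ sum (λ x → sum (λ y → ⟦ adjT t (to f x) (to f y) ⟧))
  total = ≤-reflexive (+-cancelʳ-≡ 2 _ _ (begin
    sum (λ x → sum (λ y → ⟦ adj G x y ⟧)) + 2   ≡⟨ cong (_+ 2) (handshake G) ⟩
    edgeCount G + edgeCount G + 2               ≡⟨ cong (λ e → e + e + 2) edgeCount≡ ⟩
    (n ∸ 1) + (n ∸ 1) + 2                       ≡⟨ doubled n (subst (1 ≤_) sz (≤-trans (s≤s z≤n) (depth<size (root t)))) ⟩
    n + n                                       ≡⟨ cong (λ m → m + m) (sym sz) ⟩
    size t + size t                             ≡⟨ sym (sumT-degT t) ⟩
    sumT t (degT t) + 2                         ≡⟨ cong (_+ 2) (sym (trans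
      (sum-cong-≗ (λ x → sum-↔ t f (λ q → ⟦ adjT t (to f x) q ⟧))) (sum-↔ t f (degT t)))) ⟩
    sum (λ x → sum (λ y → ⟦ adjT t (to f x) (to f y) ⟧)) + 2 ∎))
    where open ≡-Reasoning

-- Growing an embedded tree by a leaf

attach : ∀ {t} → Pos t → Tree
attach here                  = • ◁ •
attach {A ◁ B} (left p)  = attach p ◁ B
attach {A ◁ B} (right p) = A ◁ attach p

size-attach : ∀ {t} (p : Pos t) → size (attach p) ≡ suc (size t)
size-attach here              = refl
size-attach {A ◁ B} (left p)  = cong (_+ size B) (size-attach p)
size-attach {A ◁ B} (right p) = trans (cong (size A +_) (size-attach p)) (+-suc (size A) (size B))

left-injective : ∀ {A B} {p q : Pos A} → left {A} {B} p ≡ left q → p ≡ q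
left-injective refl = refl

right-injective : ∀ {A B} {p q : Pos B} → right {A} {B} p ≡ right q → p ≡ q
right-injective refl = refl

module _ {X : Set} where
  extend : ∀ {t} (p : Pos t) → (Pos t → X) → X → Pos (attach p) → X
  extend here      f z (left q)  = f here
  extend here      f z (right q) = z
  extend (left p)  f z (left q)  = extend p (f ∘ left) z q
  extend (left p)  f z (right q) = f (right q)
  extend (right p) f z (left q)  = f (left q)
  extend (right p) f z (right q) = extend p (f ∘ right) z q

  -- Attaching a leaf leaves the root in place, so the edges `◁` above p still join the same
  -- vertices.
  extend-root : ∀ {t} (p : Pos t) f z → extend p f z (root (attach p)) ≡ f (root t)
  extend-root here      f z = refl
  extend-root (left p)  f z = extend-root p (f ∘ left) z
  extend-root (right p) f z = refl

  extend-cases : ∀ {t} (p : Pos t) f z q → extend p f z q ≡ z ⊎ ∃[ q′ ] extend p f z q ≡ f q′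
  extend-cases here      f z (left q)  = inj₂ (here , refl)
  extend-cases here      f z (right q) = inj₁ refl
  extend-cases (left p)  f z (left q) with extend-cases p (f ∘ left) z q
  ... | inj₁ e       = inj₁ e
  ... | inj₂ (r , e) = inj₂ (left r , e)
  extend-cases (left p)  f z (right q) = inj₂ (right q , refl)
  extend-cases (right p) f z (left q)  = inj₂ (left q , refl)
  extend-cases (right p) f z (right q) with extend-cases p (f ∘ right) z q
  ... | inj₁ e       = inj₁ e
  ... | inj₂ (r , e) = inj₂ (right r , e)

  extend-injective : ∀ {t} (p : Pos t) f z → (∀ {q r} → f q ≡ f r → q ≡ r) → (∀ q → ¬ f q ≡ z) →
    ∀ q r → extend p f z q ≡ extend p f z r → q ≡ r
  extend-injective here f z inj new (left here)  (left here)  e = refl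
  extend-injective here f z inj new (left here)  (right here) e = contradiction e (new here)
  extend-injective here f z inj new (right here) (left here)  e = contradiction (sym e) (new here)
  extend-injective here f z inj new (right here) (right here) e = refl
  extend-injective (left p) f z inj new (left q) (left r) e =
    cong left (extend-injective p (f ∘ left) z (λ e′ → left-injective (inj e′)) (new ∘ left) q r e)
  extend-injective (left p) f z inj new (left q) (right r) e with extend-cases p (f ∘ left) z q
  ... | inj₁ e′       = contradiction (trans (sym e) e′) (new (right r))
  ... | inj₂ (s , e′) = contradiction (inj (trans (sym e′) e)) λ ()
  extend-injective (left p) f z inj new (right q) (left r) e with extend-cases p (f ∘ left) z r
  ... | inj₁ e′       = contradiction (trans e e′) (new (right q))
  ... | inj₂ (s , e′) = contradiction (inj (trans e e′)) λ ()
  extend-injective (left p) f z inj new (right q) (right r) e = cong right (right-injective (inj e))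
  extend-injective (right p) f z inj new (left q) (left r) e = cong left (left-injective (inj e))
  extend-injective (right p) f z inj new (left q) (right r) e with extend-cases p (f ∘ right) z r
  ... | inj₁ e′       = contradiction (trans e e′) (new (left q))
  ... | inj₂ (s , e′) = contradiction (inj (trans e e′)) λ ()
  extend-injective (right p) f z inj new (right q) (left r) e with extend-cases p (f ∘ right) z q
  ... | inj₁ e′       = contradiction (trans (sym e) e′) (new (left r))
  ... | inj₂ (s , e′) = contradiction (inj (trans (sym e′) e)) λ ()
  extend-injective (right p) f z inj new (right q) (right r) e =
    cong right (extend-injective p (f ∘ right) z (λ e′ → right-injective (inj e′)) (new ∘ right) q r e)

  extend-edges : (R : X → X → Set) → (∀ {x y} → R x y → R y x) → ∀ {t} (p : Pos t) f z →
    (∀ q r → adjT t q r ≡ true → R (f q) (f r)) → R (f p) z →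
    ∀ q r → adjT (attach p) q r ≡ true → R (extend p f z q) (extend p f z r)
  extend-edges R R-sym here f z old new (left here)  (right here) e = new
  extend-edges R R-sym here f z old new (right here) (left here)  e = R-sym new
  extend-edges R R-sym (left p) f z old new (left q) (left r) e =
    extend-edges R R-sym p (f ∘ left) z (λ q r → old (left q) (left r)) new q r e
  extend-edges R R-sym {A ◁ B} (left p) f z old new (left q) (right r) e
    rewrite isRoot⇒root q (proj₁ (∧-true e)) | isRoot⇒root r (proj₂ (∧-true e)) | extend-root p (f ∘ left) z =
    old (left (root A)) (right (root B)) (roots-adjacent A B)
  extend-edges R R-sym {A ◁ B} (left p) f z old new (right q) (left r) e
    rewrite isRoot⇒root r (proj₁ (∧-true e)) | isRoot⇒root q (proj₂ (∧-true e)) | extend-root p (f ∘ left) z =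
    old (right (root B)) (left (root A)) (roots-adjacent A B)
  extend-edges R R-sym (left p) f z old new (right q) (right r) e = old (right q) (right r) e
  extend-edges R R-sym (right p) f z old new (left q) (left r) e = old (left q) (left r) e
  extend-edges R R-sym {A ◁ B} (right p) f z old new (left q) (right r) e
    rewrite isRoot⇒root q (proj₁ (∧-true e)) | isRoot⇒root r (proj₂ (∧-true e)) | extend-root p (f ∘ right) z =
    old (left (root A)) (right (root B)) (roots-adjacent A B)
  extend-edges R R-sym {A ◁ B} (right p) f z old new (right q) (left r) e
    rewrite isRoot⇒root r (proj₁ (∧-true e)) | isRoot⇒root q (proj₂ (∧-true e)) | extend-root p (f ∘ right) z =
    old (right (root B)) (left (root A)) (roots-adjacent A B)
  extend-edges R R-sym (right p) f z old new (right q) (right r) e =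
    extend-edges R R-sym p (f ∘ right) z (λ q r → old (right q) (right r)) new q r e

-- A walk from the image of the tree to a missed vertex has to leave the image along some edge; the
-- new leaf is attached there.
leavingEdge : ∀ {n t} {G : Graph n} (E : Embedding t G) k x y → within G k x y ≡ true →
  (∃[ p ] φ E p ≡ x) → ¬ (∃[ p ] φ E p ≡ y) →
  ∃[ p ] ∃[ z ] ¬ (∃[ q ] φ E q ≡ z) × adj G (φ E p) z ≡ true
leavingEdge E zero x y w (p , e) missed = contradiction (p , trans e (==⇒≡ w)) missed
leavingEdge {G = G} E (suc k) x y w hit missed with ∨-true {within G k x y} w
... | inj₁ w′ = leavingEdge E k x y w′ hit missed
... | inj₂ a with anyV⁻ (λ z → adj G x z ∧ within G k z y) a
...   | z , az with ∧-true {adj G x z} az | inImage? (φ E) z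
...     | xz , zy | yes hit′ = leavingEdge E k z y zy hit′ missed
...     | xz , zy | no  new  = proj₁ hit , z , new , subst (λ x → adj G x z ≡ true) (sym (proj₂ hit)) xz

grow : ∀ {n} (G : Graph n) → Connected G → ∀ m t → size t + m ≡ n → Embedding t G → ∃[ t′ ] size t′ ≡ n × Embedding t′ G
grow G conn zero    t sz E = t , trans (sym (+-identityʳ _)) sz , E
grow {n} G conn (suc m) t sz E
  with size<⇒missed E (subst (size t <_) sz (m<m+n (size t) (s≤s z≤n)))
... | y , missed with leavingEdge E n (φ E (root t)) y (conn _ y) (root t , refl) missed
...   | p , z , new , e = grow G conn m (attach p)
  (trans (cong (_+ m) (size-attach p)) (trans (sym (+-suc (size t) m)) sz))
  (record
    { φ         = extend p (φ E) z
    ; injective = λ {q} {r} → extend-injective p (φ E) z (injective E) (λ q e → new (q , e)) q r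
    ; edges     = extend-edges (λ x y → adj G x y ≡ true) (λ {x} {y} e → trans (adj-sym G y x) e)
                    p (φ E) z (edges E) e })

IsTree⇒Iso : ∀ {n} → 1 ≤ n → (G : Graph n) → IsTree G → ∃[ t ] Iso (adj G) (adjT t)
IsTree⇒Iso {suc n} _ G (conn , edgeCount≡) with grow G conn n • refl
  (record { φ = λ _ → zero ; injective = λ { {here} {here} _ → refl } ; edges = λ { here here () } })
... | t , sz , E = t , spanning⇒Iso G edgeCount≡ sz E

-- The graph BS

≡ᵇ≡true⇒≡ : ∀ {m n} → (m ≡ᵇ n) ≡ true → m ≡ n
≡ᵇ≡true⇒≡ {m} {n} e = ≡ᵇ⇒≡ m n (Equivalence.from T-≡ e)

≡⇒≡ᵇ≡true : ∀ {m n} → m ≡ n → (m ≡ᵇ n) ≡ true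
≡⇒≡ᵇ≡true {m} {n} e = Equivalence.to T-≡ (≡⇒≡ᵇ m n e)

≢⇒≡ᵇ≡false : ∀ {m n} → ¬ m ≡ n → (m ≡ᵇ n) ≡ false
≢⇒≡ᵇ≡false {m} {n} ≢ with m ≡ᵇ n in eq
... | true  = contradiction (≡ᵇ≡true⇒≡ eq) ≢
... | false = refl

bsAdjℕ⁻ : ∀ {k x y} → bsAdjℕ k x y ≡ true → (x ≡ 0 × y ≤ k) ⊎ y ≡ x + k
bsAdjℕ⁻ {k} {x} {y} e with ∨-true e
... | inj₁ c = inj₁ (≡ᵇ≡true⇒≡ (proj₁ (∧-true c)) , ≤ᵇ≡true⇒≤ (proj₂ (∧-true {1 ≤ᵇ y} (proj₂ (∧-true {x ≡ᵇ 0} c)))))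
... | inj₂ c = inj₂ (≡ᵇ≡true⇒≡ (proj₂ (∧-true {1 ≤ᵇ x} c)))

bsAdjℕ-centre : ∀ {k y} → 1 ≤ y → y ≤ k → bsAdjℕ k 0 y ≡ true
bsAdjℕ-centre 1≤y y≤k rewrite ≤⇒≤ᵇ≡true 1≤y | ≤⇒≤ᵇ≡true y≤k = refl

bsAdjℕ-leg : ∀ {k x y} → 1 ≤ x → y ≡ x + k → bsAdjℕ k x y ≡ true
bsAdjℕ-leg {k} {x} {y} 1≤x e rewrite ≤⇒≤ᵇ≡true 1≤x | ≡⇒≡ᵇ≡true e = ∨-zeroʳ _

-- The neighbour of y below y is y ∸ k: truncation covers the centre.
bsAdj-parent : ∀ {k x y} → 1 ≤ k → 1 ≤ y →
  (x <ᵇ y) ∧ (not (x ≡ᵇ y) ∧ (bsAdjℕ k x y ∨ bsAdjℕ k y x)) ≡ (x ≡ᵇ y ∸ k)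
bsAdj-parent {k} {x} {y} 1≤k 1≤y = ≡true-ext
  (λ e → ≡⇒≡ᵇ≡true (⇒ (<ᵇ⇒< x y (Equivalence.from T-≡ (proj₁ (∧-true e))))
                      (∨-true (proj₂ (∧-true {not (x ≡ᵇ y)} (proj₂ (∧-true {x <ᵇ y} e)))))))
  (λ e → ⇐ (≡ᵇ≡true⇒≡ e))
  where
  ⇒ : x < y → bsAdjℕ k x y ≡ true ⊎ bsAdjℕ k y x ≡ true → x ≡ y ∸ k
  ⇒ x<y (inj₁ e) with bsAdjℕ⁻ {k} {x} {y} e
  ... | inj₁ (refl , y≤k) = sym (m≤n⇒m∸n≡0 y≤k)
  ... | inj₂ refl         = sym (m+n∸n≡m x k)
  ⇒ x<y (inj₂ e) with bsAdjℕ⁻ {k} {y} {x} e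
  ... | inj₁ (refl , _) = contradiction 1≤y λ ()
  ... | inj₂ refl       = contradiction x<y (≤⇒≯ (m≤m+n y k))
  adjacent-parent : x ≡ y ∸ k → bsAdjℕ k x y ≡ true
  adjacent-parent refl with y ≤? k
  ... | yes y≤k rewrite m≤n⇒m∸n≡0 y≤k = bsAdjℕ-centre 1≤y y≤k
  ... | no  y≰k = bsAdjℕ-leg (m<n⇒0<n∸m (≰⇒> y≰k)) (sym (m∸n+n≡m (<⇒≤ (≰⇒> y≰k))))
  below : x ≡ y ∸ k → x < y
  below refl = ∸-< 1≤k 1≤y
    where
    ∸-< : ∀ {k y} → 1 ≤ k → 1 ≤ y → y ∸ k < y
    ∸-< {suc k} {suc y} _ _ = s≤s (m∸n≤m y k)
  ⇐ : x ≡ y ∸ k → (x <ᵇ y) ∧ (not (x ≡ᵇ y) ∧ (bsAdjℕ k x y ∨ bsAdjℕ k y x)) ≡ true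
  ⇐ e rewrite Equivalence.to T-≡ (<⇒<ᵇ (below e)) | ≢⇒≡ᵇ≡false (<⇒≢ (below e)) | adjacent-parent e = refl

sum-single : ∀ n c → c < n → sum {n} (λ x → ⟦ toℕ x ≡ᵇ c ⟧) ≡ 1
sum-single (suc n) zero    _         = cong suc (trans (sum-const n 0) (*-zeroʳ n))
sum-single (suc n) (suc c) (s≤s c<n) = sum-single n c c<n

-- The edges are counted by their larger end: each vertex y other than 0 has exactly one smaller
-- neighbour, y ∸ k.
edgeCount-BS : ∀ n k → 1 ≤ n → 1 ≤ k → edgeCount (BS n k) ≡ n ∸ 1
edgeCount-BS (suc n) k _ 1≤k = begin
  edgeCount (BS (suc n) k)                ≡⟨ edgeCount-upper (BS (suc n) k) ⟩
  sum (λ x → sum (λ y → edge x y))        ≡⟨ ∑-comm edge ⟩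
  sum (λ y → sum (λ x → edge x y))        ≡⟨⟩
  sum (λ x → edge x zero) + sum (λ y → sum (λ x → edge x (suc y)))
    ≡⟨ cong₂ _+_ (trans (sum-const (suc n) 0) (*-zeroʳ n))
         (trans (sum-cong-≗ parents) (trans (sum-const n 1) (*-identityʳ n))) ⟩
  n ∎
  where
  open ≡-Reasoning
  edge : Fin (suc n) → Fin (suc n) → ℕ
  edge x y = if toℕ x <ᵇ toℕ y then ⟦ bsAdj k x y ⟧ else 0
  if-∧ : ∀ a b → (if a then ⟦ b ⟧ else 0) ≡ ⟦ a ∧ b ⟧
  if-∧ true  b = refl
  if-∧ false b = refl
  parents : ∀ y → sum (λ x → edge x (suc y)) ≡ 1
  parents y = trans (sum-cong-≗ (λ x → trans (if-∧ (toℕ x <ᵇ suc (toℕ y)) (bsAdj k x (suc y)))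
      (cong ⟦_⟧ (bsAdj-parent {k} {toℕ x} 1≤k (s≤s z≤n)))))
    (sum-single (suc n) (suc (toℕ y) ∸ k) (≤-<-trans (m∸n≤m (suc (toℕ y)) k) (s≤s (toℕ<n y))))

-- A balanced spider inside `BS`

chain-depth-injective : ∀ m {p q : Pos (chain m)} → depth p ≡ depth q → p ≡ q
chain-depth-injective zero    {here}      {here}      _ = refl
chain-depth-injective (suc m) {left here} {left here} _ = refl
chain-depth-injective (suc m) {left here} {right q}   ()
chain-depth-injective (suc m) {right p}   {left here} ()
chain-depth-injective (suc m) {right p}   {right q}   e = cong right (chain-depth-injective m (suc-injective e))

adj⇒depth : ∀ t (p q : Pos t) → adjT t p q ≡ true → depth q ≡ suc (depth p) ⊎ depth p ≡ suc (depth q)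
adj⇒depth (A ◁ B) (left p)  (left q)  e = adj⇒depth A p q e
adj⇒depth (A ◁ B) (left p)  (right q) e
  rewrite isRoot⇒root p (proj₁ (∧-true e)) | isRoot⇒root q (proj₂ (∧-true e)) | depth-root A | depth-root B = inj₁ refl
adj⇒depth (A ◁ B) (right p) (left q)  e
  rewrite isRoot⇒root q (proj₁ (∧-true e)) | isRoot⇒root p (proj₂ (∧-true e)) | depth-root A | depth-root B = inj₂ refl
adj⇒depth (A ◁ B) (right p) (right q) e with adj⇒depth B p q e
... | inj₁ d = inj₁ (cong suc d)
... | inj₂ d = inj₂ (cong suc d)

-- Labels of the spider with legs number j, j + 1, … : the vertex at depth i + 1
-- of leg number j becomes the vertex 1 + j + i k of BS.
module Labelling (k : ℕ) .{{_ : NonZero k}} where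

  label : ∀ j L → Pos (spider L) → ℕ
  label j []      here      = 0
  label j (m ∷ L) (left p)  = label (suc j) L p
  label j (m ∷ L) (right p) = suc (j + depth p * k)

  label-root : ∀ j L → label j L (root (spider L)) ≡ 0
  label-root j []      = refl
  label-root j (m ∷ L) = label-root (suc j) L

  leg-unique : ∀ {j i j′ i′} → j < k → j′ < k → j + i * k ≡ j′ + i′ * k → j ≡ j′
  leg-unique {j} {i} {j′} {i′} j<k j′<k e = begin
    j                  ≡⟨ sym (m<n⇒m%n≡m j<k) ⟩
    j % k              ≡⟨ sym ([m+kn]%n≡m%n j i k) ⟩
    (j + i * k) % k    ≡⟨ cong (_% k) e ⟩
    (j′ + i′ * k) % k  ≡⟨ [m+kn]%n≡m%n j′ i′ k ⟩
    j′ % k             ≡⟨ m<n⇒m%n≡m j′<k ⟩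
    j′                 ∎
    where open ≡-Reasoning

  label-cases : ∀ j L (p : Pos (spider L)) → label j L p ≡ 0 ⊎
    ∃[ j′ ] ∃[ i ] label j L p ≡ suc (j′ + i * k) × j ≤ j′ × j′ < j + length L
  label-cases j []      here = inj₁ refl
  label-cases j (m ∷ L) (right p) = inj₂ (j , depth p , refl , ≤-refl , m<m+n j (s≤s z≤n))
  label-cases j (m ∷ L) (left p) with label-cases (suc j) L p
  ... | inj₁ e = inj₁ e
  ... | inj₂ (j′ , i , e , j<j′ , j′<) = inj₂ (j′ , i , e , <⇒≤ j<j′ , subst (j′ <_) (sym (+-suc j (length L))) j′<)

  label-≢ : ∀ {j m} L (p : Pos (spider L)) (q : Pos (chain m)) → j + suc (length L) ≤ k →
    ¬ label (suc j) L p ≡ suc (j + depth q * k)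
  label-≢ {j} L p q ≤k e with label-cases (suc j) L p
  ... | inj₁ e′ = contradiction (trans (sym e′) e) λ ()
  ... | inj₂ (j′ , i , e′ , j<j′ , j′<) = <⇒≢ j<j′ (leg-unique {j} {depth q} {j′} {i}
    (<-≤-trans (m<m+n j (s≤s z≤n)) ≤k) (<-≤-trans j′< (≤-trans (≤-reflexive (sym (+-suc j (length L)))) ≤k))
    (suc-injective (trans (sym e) e′)))

  label-injective : ∀ j L → j + length L ≤ k → ∀ p q → label j L p ≡ label j L q → p ≡ q
  label-injective j []      _  here      here      _ = refl
  label-injective j (m ∷ L) ≤k (left p)  (left q)  e =
    cong left (label-injective (suc j) L (subst (_≤ k) (+-suc j (length L)) ≤k) p q e)
  label-injective j (m ∷ L) ≤k (left p)  (right q) e = contradiction e (label-≢ L p q ≤k)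
  label-injective j (m ∷ L) ≤k (right p) (left q)  e = contradiction (sym e) (label-≢ L q p ≤k)
  label-injective j (m ∷ L) ≤k (right p) (right q) e =
    cong right (chain-depth-injective m (*-cancelʳ-≡ _ _ k (+-cancelˡ-≡ j _ _ (suc-injective e))))

  next-in-leg : ∀ j x → suc (j + (k + x)) ≡ suc (j + x) + k
  next-in-leg j x = cong suc (trans (cong (j +_) (+-comm k x)) (sym (+-assoc j x k)))

  label-edges : ∀ j L → j + length L ≤ k → ∀ p q → adjT (spider L) p q ≡ true →
    bsAdjℕ k (label j L p) (label j L q) ∨ bsAdjℕ k (label j L q) (label j L p) ≡ true
  label-edges j (m ∷ L) ≤k (left p)  (left q)  e =
    label-edges (suc j) L (subst (_≤ k) (+-suc j (length L)) ≤k) p q e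
  label-edges j (m ∷ L) ≤k (left p)  (right q) e
    rewrite isRoot⇒root p (proj₁ (∧-true e)) | isRoot⇒root q (proj₂ (∧-true e))
          | label-root (suc j) L | depth-root (chain m) | +-identityʳ j
          | bsAdjℕ-centre {k} {suc j} (s≤s z≤n) (≤-trans (m<m+n j (s≤s z≤n)) ≤k) = refl
  label-edges j (m ∷ L) ≤k (right p) (left q)  e
    rewrite isRoot⇒root q (proj₁ (∧-true e)) | isRoot⇒root p (proj₂ (∧-true e))
          | label-root (suc j) L | depth-root (chain m) | +-identityʳ j
          | bsAdjℕ-centre {k} {suc j} (s≤s z≤n) (≤-trans (m<m+n j (s≤s z≤n)) ≤k) = refl
  label-edges j (m ∷ L) ≤k (right p) (right q) e with adj⇒depth (chain m) p q e
  ... | inj₁ d rewrite bsAdjℕ-leg {k} {suc (j + depth p * k)} {suc (j + depth q * k)} (s≤s z≤n)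
                         (trans (cong (λ d → suc (j + d * k)) d) (next-in-leg j (depth p * k))) = refl
  ... | inj₂ d rewrite bsAdjℕ-leg {k} {suc (j + depth q * k)} {suc (j + depth p * k)} (s≤s z≤n)
                         (trans (cong (λ d → suc (j + d * k)) d) (next-in-leg j (depth q * k))) = ∨-zeroʳ (bsAdjℕ k (suc (j + depth p * k)) (suc (j + depth q * k)))

  -- Labels increase along a leg, so it suffices that the label of its last vertex, at position m of
  -- leg j, is below n.
  Fits : ℕ → ℕ → List ℕ → Set
  Fits n j []      = 1 ≤ n
  Fits n j (m ∷ L) = suc (j + m * k) < n × Fits n (suc j) L

  label< : ∀ {n} j L → Fits n j L → ∀ p → label j L p < n
  label< j []      1≤n        here      = 1≤n
  label< j (m ∷ L) (_ , fits) (left p)  = label< (suc j) L fits p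
  label< j (m ∷ L) (lt , _)   (right p) =
    ≤-<-trans (s≤s (+-monoʳ-≤ j (*-monoˡ-≤ k (s≤s⁻¹ (subst (depth p <_) (size-chain m) (depth<size p)))))) lt

  fits-replicate : ∀ {n} x j m {L} → (∀ i → i < x → suc (j + i + m * k) < n) → Fits n (j + x) L → Fits n j (replicate x m ++ L)
  fits-replicate {n} zero    j m {L} _  fits = subst (λ i → Fits n i L) (+-identityʳ j) fits
  fits-replicate {n} (suc x) j m {L} lt fits =
      subst (λ i → suc (i + m * k) < n) (+-identityʳ j) (lt 0 (s≤s z≤n))
    , fits-replicate x (suc j) m
        (λ i i<x → subst (λ j → suc (j + m * k) < n) (+-suc j i) (lt (suc i) (s≤s i<x)))
        (subst (λ i → Fits n i L) (+-suc j x) fits)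

  spiderEmbedding : ∀ {n} L → length L ≤ k → Fits n 0 L → Embedding (spider L) (BS n k)
  spiderEmbedding {n} L ≤k fits = record
    { φ         = f
    ; injective = inj
    ; edges     = λ p q e → cong₂ _∧_
        (cong not (≢⇒≡ᵇ≡false (λ same → contradiction (trans (sym e)
          (trans (cong (adjT (spider L) p) (sym (inj (toℕ-injective same)))) (adjT-irrefl (spider L) p))) λ ())))
        (trans (cong₂ (λ x y → bsAdjℕ k x y ∨ bsAdjℕ k y x) (toℕ-f p) (toℕ-f q)) (label-edges 0 L ≤k p q e)) }
    where
    f : Pos (spider L) → Fin n
    f p = fromℕ< (label< 0 L fits p)
    toℕ-f : ∀ p → toℕ (f p) ≡ label 0 L p
    toℕ-f p = toℕ-fromℕ< (label< 0 L fits p)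
    inj : ∀ {p q} → f p ≡ f q → p ≡ q
    inj {p} {q} e = label-injective 0 L ≤k p q (trans (sym (toℕ-f p)) (trans (cong toℕ e) (toℕ-f q)))

size-balanced : ∀ b s u → size (balanced (suc b) s u) ≡ 2 + (s + suc b * suc (s + u))
size-balanced b s u = begin
  size (balanced (suc b) s u)                                  ≡⟨ size-spider-replicate (suc s) (suc b) (replicate u b) ⟩
  suc s * (2 + b) + size (spider (replicate u b))
    ≡⟨ cong (λ L → suc s * (2 + b) + size (spider L)) (sym (++-identityʳ (replicate u b))) ⟩
  suc s * (2 + b) + size (spider (replicate u b ++ []))        ≡⟨ cong (suc s * (2 + b) +_) (size-spider-replicate u b []) ⟩
  suc s * (2 + b) + (u * suc b + 1)                            ≡⟨ lem s u b ⟩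
  2 + (s + suc b * suc (s + u))                                ∎
  where
  open ≡-Reasoning
  lem : ∀ s u b → suc s * (2 + b) + (u * suc b + 1) ≡ 2 + (s + suc b * suc (s + u))
  lem = solve-∀

balancedEmbedding : ∀ {n k} b s u → k ≡ suc (s + u) → n ≡ 2 + (s + suc b * k) →
  Embedding (balanced (suc b) s u) (BS n k)
balancedEmbedding {n} {k@(suc _)} b s u k≡ n≡ = spiderEmbedding (legs (suc b) s u)
  (≤-reflexive (trans (cong suc (length-otherLegs b s u)) (sym k≡)))
  -- The long legs are numbers 0, ..., s. Leg i ends at the label 1 + i + (b + 1)k, and for i = s
  -- this is n - 1, the last vertex of `BS`.
  (fits-replicate (suc s) 0 (suc b) (λ i i≤s → <n (s≤s (s≤s (+-monoˡ-≤ (suc b * k) (s≤s⁻¹ i≤s)))))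
    (subst (Fits n (suc s)) (++-identityʳ (replicate u b)) (fits-replicate u (suc s) b lower (<n (s≤s z≤n)))))
  where
  open Labelling k
  <n : ∀ {x} → x < 2 + (s + suc b * k) → x < n
  <n = subst (_ <_) (sym n≡)
  lower : ∀ i → i < u → suc (suc s + i + b * k) < n
  lower i i<u = <n (s≤s (s≤s (begin
    suc (s + i) + b * k      ≤⟨ +-monoˡ-≤ (b * k) (s≤s (+-monoʳ-≤ s (<⇒≤ i<u))) ⟩
    suc (s + u) + b * k      ≡⟨ cong (_+ b * k) (sym k≡) ⟩
    k + b * k                ≤⟨ m≤n+m _ s ⟩
    s + suc b * k            ∎)))
    where open ≤-Reasoning

-- Comparison of an arbitrary tree with `BS`

module Comparison {n k} (3≤k : 3 ≤ k) (b s u : ℕ) (k≡ : k ≡ suc (s + u)) (n≡ : n ≡ 2 + (s + suc b * k)) where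
  W : Tree
  W = balanced (suc b) s u

  1≤n : 1 ≤ n
  1≤n = subst (1 ≤_) (sym n≡) (s≤s z≤n)

  2≤s+u : 2 ≤ s + u
  2≤s+u = s≤s⁻¹ (subst (3 ≤_) k≡ 3≤k)

  size-W : size W ≡ n
  size-W = trans (size-balanced b s u) (trans (cong (λ k → 2 + (s + suc b * k)) (sym k≡)) (sym n≡))

  BS-edges : edgeCount (BS n k) ≡ n ∸ 1
  BS-edges = edgeCount-BS n k 1≤n (≤-trans (s≤s z≤n) 3≤k)

  BS-iso : Iso (adj (BS n k)) (adjT W)
  BS-iso = spanning⇒Iso (BS n k) BS-edges size-W (balancedEmbedding b s u k≡ n≡)

  BS-pendents : pendentCount (BS n k) ≡ k
  BS-pendents = trans (Iso⇒pendentCount (BS n k) W BS-iso) (trans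
    (pendents-spider (suc b) (otherLegs b s u) (subst (1 ≤_) (sym (length-otherLegs b s u)) (<⇒≤ 2≤s+u)))
    (trans (cong suc (length-otherLegs b s u)) (sym k≡)))

  module _ (T : Graph n) (pendents-T : pendentCount T ≡ k) (t : Tree) (rep : Iso (adj T) (adjT t)) where
    size-t : size t ≡ size W
    size-t = trans (sym (Iso⇒n≡size T t rep)) (sym size-W)

    pendents-t : pendents t ≡ suc (s + u)
    pendents-t = trans (sym (Iso⇒pendentCount T t rep)) (trans pendents-T k≡)

    near≤ : ∀ D → near t D ≤ near W D
    near≤ = balanced-extremal (suc b) s u (inj₁ (s≤s z≤n)) t size-t pendents-t

    harary≤ : harary T ℚ.≤ harary (BS n k)
    harary≤ = subst₂ ℚ._≤_ (sym (harary-abel T t rep n (n≤1+n n))) (sym (harary-abel (BS n k) W BS-iso n (n≤1+n n)))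
      (abel-mono n near≤)

    near≡ : harary T ≡ harary (BS n k) → ∀ D → near t D ≡ near W D
    near≡ eq zero    = trans (near-zero t) (sym (near-zero W))
    -- `abel-injective` reaches only indices up to its bound; n + D is large enough for both the
    -- index `suc D` and the representation of the Harary index.
    near≡ eq (suc D) = abel-injective (n + D) near≤
        (trans (sym (harary-abel T t rep (n + D) n≤)) (trans eq (harary-abel (BS n k) W BS-iso (n + D) n≤)))
        D (m<n+m D 1≤n)
      where
      n≤ : n ≤ suc (n + D)
      n≤ = ≤-trans (m≤m+n n D) (n≤1+n (n + D))

    harary≡⇒Iso : harary T ≡ harary (BS n k) → Iso (adj T) (adj (BS n k))
    harary≡⇒Iso eq = Iso-trans rep (Iso-trans
      (balanced-unique b s u 2≤s+u t size-t pendents-t (near≡ eq)) (Iso-sym BS-iso))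

-- It is n - 2 that is divided by k: then n - 1 = (s + 1) + (b + 1)k with 0 ≤ s < k, so at least one
-- leg has the greater length and can be shortened. The quotient is positive because k ≤ n - 2.
divide : ∀ n k → 3 ≤ k → k + 2 ≤ n →
  ∃[ b ] ∃[ s ] ∃[ u ] k ≡ suc (s + u) × n ≡ 2 + (s + suc b * k)
divide n (suc k′) _ k+2≤n with positive (m≥n⇒m/n>0 {n ∸ 2} {suc k′} k≤n∸2)
  where
  k≤n∸2 : suc k′ ≤ n ∸ 2
  k≤n∸2 = subst (_≤ n ∸ 2) (m+n∸n≡m (suc k′) 2) (∸-monoˡ-≤ 2 k+2≤n)
... | b , n/k = b , s , k′ ∸ s , cong suc (sym s+u) , (begin
  n                                       ≡⟨ sym (m+[n∸m]≡n (≤-trans (m≤n+m 2 (suc k′)) k+2≤n)) ⟩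
  2 + (n ∸ 2)                             ≡⟨ cong (2 +_) (m≡m%n+[m/n]*n (n ∸ 2) (suc k′)) ⟩
  2 + (s + (n ∸ 2) / suc k′ * suc k′)     ≡⟨ cong (λ x → 2 + (s + x * suc k′)) n/k ⟩
  2 + (s + suc b * suc k′)                ∎)
  where
  open ≡-Reasoning
  s = (n ∸ 2) % suc k′
  s+u : s + (k′ ∸ s) ≡ k′
  s+u = m+[n∸m]≡n (s≤s⁻¹ (m%n<n (n ∸ 2) (suc k′)))

theorem3p1 : (n k : ℕ) → 3 ≤ k → k + 2 ≤ n →
    (IsTree (BS n k) × pendentCount (BS n k) ≡ k) ×
    ((T : Graph n) → IsTree T → pendentCount T ≡ k →
    (harary T ℚ.≤ harary (BS n k)) × (harary T ≡ harary (BS n k) → T ≅ BS n k))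
theorem3p1 n k 3≤k k+2≤n with divide n k 3≤k k+2≤n
... | b , s , u , k≡ , n≡ =
    ((Iso⇒connected (BS n k) C.W C.BS-iso , C.BS-edges) , C.BS-pendents)
  , λ T isTree pend →
      let t , rep = IsTree⇒Iso C.1≤n T isTree
      in C.harary≤ T pend t rep
       , λ eq → let e = C.harary≡⇒Iso T pend t rep eq in bij e , adjacent e
  where module C = Comparison 3≤k b s u k≡ n≡
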